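{- The following are equivalent: (a) the continuum hypothesis, $2^{\aleph_0} = \aleph_1$; (b) (Keisler's criterion) if $\mathcal{L}$ is a countable first-order language and $\mathbf{M}, \mathbf{N}$ are $\mathcal{L}$-structures of size $\leq 2^{\aleph_0}$, then $\mathbf{M} \equiv \mathbf{N}$ if and only if there exists an ultrafilter $\mathcal{U}$ on $\omega$ such that $\mathbf{M}^{\omega}/\mathcal{U} \simeq \mathbf{N}^{\omega}/\mathcal{U}$.
   Context: The ambient theory is ZFC. The size of a structure is the cardinality of its universe. $\mathbf{M} \equiv \mathbf{N}$ denotes elementary equivalence, $\mathbf{M}^{\omega}/\mathcal{U}$ denotes the ultrapower of $\mathbf{M}$ by the ultrafilter $\mathcal{U}$ on $\omega$, and $\simeq$ denotes isomorphism of structures. -}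

module Defs where

open import Axiom.ExcludedMiddle using (ExcludedMiddle)
open import Axiom.Extensionality.Propositional using (Extensionality)
open import Data.Bool.Base using (Bool)
open import Data.Fin.Base using (Fin; zero; suc)
open import Data.Nat.Base using (ℕ; zero; suc)
open import Data.Product.Base using (∃; _×_; _,_)
open import Data.Sum.Base using (_⊎_)
open import Data.Vec.Functional using (Vector; []; _∷_)
open import Data.Vec.Functional.Relation.Binary.Pointwise using (Pointwise)
open import Function.Base using (_∘_)
open import Function.Bundles
  using (_⇔_; mk⇔; _↔_; _↣_; Injection; Bijection; module Inverse; module Equivalence)
open import Function.Construct.Composition using (_⇔-∘_; _↔-∘_)
open import Function.Construct.Identity using (⇔-id; ↔-id)
open import Function.Construct.Symmetry using (↔-sym)
open import Induction.WellFounded using (WellFounded)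
open import Level using (0ℓ; Setω) renaming (suc to lsuc)
open import Relation.Binary.Bundles using (Setoid)
open import Relation.Binary.Core using (Rel)
open import Relation.Binary.Structures using (IsStrictTotalOrder)
open import Relation.Binary.PropositionalEquality using (_≡_; sym; subst₂; _→-setoid_)
open import Relation.Nullary.Negation using (¬_)
open import Relation.Unary using (Pred; _∈_; _∩_; _⊆_; ∅; ∁; U)

------------------------------------------------------------------------
-- Classical set theory

-- ZFC as the ambient theory, in the form of explicit assumptions.
-- Excluded middle ranges over arbitrary types, so it yields an element
-- of every type that is not empty: it is a choice principle as well.
-- Function extensionality makes such choices depend only on the
-- extension of a Bool-valued subset, which gives choice for families
-- of subsets and quotients (hence well-orderings, ultrafilters, ...).

record Classical : Setω where
  field
    excludedMiddle : ∀ {ℓ} → ExcludedMiddle ℓ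
    extensionality : ∀ {a b} → Extensionality a b

------------------------------------------------------------------------
-- Cardinals

-- 2^ℕ, with pointwise equality.

Continuum : Setoid 0ℓ 0ℓ
Continuum = ℕ →-setoid Bool

-- ω₁ is the set of countable (finite or denumerable) ordinals, an
-- ordinal being presented by a well-ordered set of that order type;
-- ordinals are equal when the well-orders are isomorphic.

record CountableOrdinal : Set₁ where
  infix 4 _<_
  field
    Carrier            : Set
    _<_                : Rel Carrier 0ℓ
    isStrictTotalOrder : IsStrictTotalOrder _≡_ _<_
    wellFounded        : WellFounded _<_
    countable          : Carrier ↣ ℕ

infix 4 _≅ᵒ_

record _≅ᵒ_ (α β : CountableOrdinal) : Set where
  private
    module α = CountableOrdinal α
    module β = CountableOrdinal β
  field
    bijection : α.Carrier ↔ β.Carrier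
  open Inverse bijection public using (to; from; strictlyInverseˡ)
  field
    order : ∀ {x y} → (x α.< y) ⇔ (to x β.< to y)

≅ᵒ-refl : ∀ {α} → α ≅ᵒ α
≅ᵒ-refl = record { bijection = ↔-id _ ; order = ⇔-id _ }

≅ᵒ-sym : ∀ {α β} → α ≅ᵒ β → β ≅ᵒ α
≅ᵒ-sym {α} {β} α≅β = record
  { bijection = ↔-sym bijection
  ; order     = λ {x} {y} → mk⇔
      (λ x<y → Equivalence.from order
        (subst₂ β._<_ (sym (strictlyInverseˡ x)) (sym (strictlyInverseˡ y)) x<y))
      (λ x<y → subst₂ β._<_ (strictlyInverseˡ x) (strictlyInverseˡ y)
        (Equivalence.to order x<y))
  }
  where
  open _≅ᵒ_ α≅β
  module β = CountableOrdinal β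

≅ᵒ-trans : ∀ {α β γ} → α ≅ᵒ β → β ≅ᵒ γ → α ≅ᵒ γ
≅ᵒ-trans α≅β β≅γ = record
  { bijection = _≅ᵒ_.bijection β≅γ ↔-∘ _≅ᵒ_.bijection α≅β
  ; order     = _≅ᵒ_.order β≅γ ⇔-∘ _≅ᵒ_.order α≅β
  }

ω₁ : Setoid (lsuc 0ℓ) 0ℓ
ω₁ = record
  { Carrier       = CountableOrdinal
  ; _≈_           = _≅ᵒ_
  ; isEquivalence = record
    { refl  = λ {α} → ≅ᵒ-refl {α}
    ; sym   = ≅ᵒ-sym
    ; trans = ≅ᵒ-trans
    }
  }

-- 2^ℵ₀ = ℵ₁

ContinuumHypothesis : Set₁
ContinuumHypothesis = Bijection Continuum ω₁

------------------------------------------------------------------------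
-- First-order languages and structures

-- Constants are function symbols of arity 0.

record Language : Set₁ where
  field
    FunSym   : Set
    RelSym   : Set
    funArity : FunSym → ℕ
    relArity : RelSym → ℕ

CountableLanguage : Language → Set
CountableLanguage L = (FunSym ↣ ℕ) × (RelSym ↣ ℕ)
  where open Language L

-- The universe is a setoid, so that ultrapowers, which are quotients,
-- are again structures.

record Structure (L : Language) : Set₁ where
  open Language L
  field
    universe : Setoid 0ℓ 0ℓ
  open Setoid universe public
  field
    inhabitant : Carrier
    fun        : (f : FunSym) → Vector Carrier (funArity f) → Carrier
    fun-cong   : ∀ f {xs ys} → Pointwise _≈_ xs ys → fun f xs ≈ fun f ys
    rel        : (R : RelSym) → Vector Carrier (relArity R) → Set
    rel-resp   : ∀ R {xs ys} → Pointwise _≈_ xs ys → rel R xs → rel R ys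

SizeAtMostContinuum : ∀ {L} → Structure L → Set
SizeAtMostContinuum M = Injection (Structure.universe M) Continuum

infix 4 _≃_

record _≃_ {L : Language} (M N : Structure L) : Set where
  open Language L
  private
    module M = Structure M
    module N = Structure N
  field
    bijection : Bijection M.universe N.universe
  open Bijection bijection public using (to)
  field
    fun-homo : ∀ f xs → to (M.fun f xs) N.≈ N.fun f (to ∘ xs)
    rel-iso  : ∀ R xs → M.rel R xs ⇔ N.rel R (to ∘ xs)

------------------------------------------------------------------------
-- First-order logic with equality

-- Terms and formulas with variables among v₀, …, vₙ₋₁; a quantifier
-- binds v₀ of its body and shifts the other variables by one.

data Term (L : Language) (n : ℕ) : Set where
  var : Fin n → Term L n
  app : (f : Language.FunSym L) → Vector (Term L n) (Language.funArity L f) → Term L n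

infix  8 _≐_
infix  7 ¬′_
infixr 6 _∧′_
infixr 5 _∨′_
infixr 4 _⇒′_

data Formula (L : Language) (n : ℕ) : Set where
  _≐_            : Term L n → Term L n → Formula L n
  atom           : (R : Language.RelSym L) → Vector (Term L n) (Language.relArity L R) →
                   Formula L n
  ¬′_            : Formula L n → Formula L n
  _∧′_ _∨′_ _⇒′_ : Formula L n → Formula L n → Formula L n
  ∀′ ∃′          : Formula L (suc n) → Formula L n

Sentence : Language → Set
Sentence L = Formula L 0

module _ {L : Language} (M : Structure L) where
  open Structure M

  ⟦_⟧ : ∀ {n} → Term L n → Vector Carrier n → Carrier
  ⟦ var i ⟧    ρ = ρ i
  ⟦ app f ts ⟧ ρ = fun f (λ j → ⟦ ts j ⟧ ρ)

  Satisfies : ∀ {n} → Formula L n → Vector Carrier n → Set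
  Satisfies (s ≐ t)     ρ = ⟦ s ⟧ ρ ≈ ⟦ t ⟧ ρ
  Satisfies (atom R ts) ρ = rel R (λ j → ⟦ ts j ⟧ ρ)
  Satisfies (¬′ φ)      ρ = ¬ Satisfies φ ρ
  Satisfies (φ ∧′ ψ)    ρ = Satisfies φ ρ × Satisfies ψ ρ
  Satisfies (φ ∨′ ψ)    ρ = Satisfies φ ρ ⊎ Satisfies ψ ρ
  Satisfies (φ ⇒′ ψ)    ρ = Satisfies φ ρ → Satisfies ψ ρ
  Satisfies (∀′ φ)      ρ = ∀ x → Satisfies φ (x ∷ ρ)
  Satisfies (∃′ φ)      ρ = ∃ λ x → Satisfies φ (x ∷ ρ)

infix 4 _⊨_ _≡ₑ_

_⊨_ : ∀ {L} → Structure L → Sentence L → Set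
M ⊨ φ = Satisfies M φ []

_≡ₑ_ : ∀ {L} → Structure L → Structure L → Set
_≡ₑ_ {L} M N = (φ : Sentence L) → (M ⊨ φ) ⇔ (N ⊨ φ)

------------------------------------------------------------------------
-- Ultrapowers

-- Principal ultrafilters are allowed.

record Ultrafilter (I : Set) : Set₁ where
  field
    Large        : Pred (Pred I 0ℓ) 0ℓ
    full         : Large U
    proper       : ¬ Large ∅
    upward       : ∀ {X Y} → X ⊆ Y → Large X → Large Y
    intersection : ∀ {X Y} → Large X → Large Y → Large (X ∩ Y)
    ultra        : ∀ X → Large X ⊎ Large (∁ X)

  finiteIntersection : ∀ {n} (X : Fin n → Pred I 0ℓ) →
                       (∀ j → Large (X j)) → Large (λ i → ∀ j → X j i)
  finiteIntersection {zero}  X h = upward (λ _ ()) full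
  finiteIntersection {suc n} X h =
    upward (λ { (x , _) zero → x ; (_ , xs) (suc j) → xs j })
           (intersection (h zero) (finiteIntersection (X ∘ suc) (h ∘ suc)))

-- Elements are functions I → M, equal when they agree on a large set.

ultrapower : ∀ {L} {I : Set} → Structure L → Ultrafilter I → Structure L
ultrapower {L} {I} M 𝒰 = record
  { universe = record
    { Carrier       = I → M.Carrier
    ; _≈_           = λ a b → Large (λ i → a i M.≈ b i)
    ; isEquivalence = record
      { refl  = upward (λ _ → M.refl) full
      ; sym   = upward M.sym
      ; trans = λ p q → upward (λ (x , y) → M.trans x y) (intersection p q)
      }
    }
  ; inhabitant = λ _ → M.inhabitant
  ; fun        = λ f as i → M.fun f (λ j → as j i)
  ; fun-cong   = λ f as≈bs → upward (M.fun-cong f) (finiteIntersection _ as≈bs)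
  ; rel        = λ R as → Large (λ i → M.rel R (λ j → as j i))
  ; rel-resp   = λ R as≈bs r →
      upward (λ (e , x) → M.rel-resp R e x)
             (intersection (finiteIntersection _ as≈bs) r)
  }
  where
  module M = Structure M
  open Ultrafilter 𝒰

------------------------------------------------------------------------

KeislerCriterion : Set₁
KeislerCriterion =
  (L : Language) → CountableLanguage L →
  (M N : Structure L) → SizeAtMostContinuum M → SizeAtMostContinuum N →
  (M ≡ₑ N) ⇔ (∃ λ (𝒰 : Ultrafilter ℕ) → ultrapower M 𝒰 ≃ ultrapower N 𝒰)

{-# OPTIONS --safe #-}
module Submission where

-- Suppose CH. The continuum has a well-ordering with countable initial segments. It yields a
-- nonprincipal ultrafilter 𝒰 on ω, ultrapowers by 𝒰 are ℵ₁-saturated and have at most 2^ℵ₀ elements,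
-- and a back-and-forth construction along the well-ordering makes elementarily equivalent ones
-- isomorphic. The other direction of Keisler's criterion is Łoś's theorem.
--
-- Suppose CH fails. Well-order the continuum; let J₁ consist of the points with countably many
-- predecessors and J₂ of those with at most ℵ₁ predecessors. The dense linear orders J₁ × ℚ and
-- J₂ × ℚ are elementarily equivalent. In J₁ every countable set is bounded, so the constant sequences
-- are cofinal in each ultrapower of J₁ × ℚ, which thus has cofinality ℵ₁; but in J₂ every set of size
-- ℵ₁ is bounded, so ultrapowers of J₂ × ℚ have larger cofinality.

open import Defs
open import Axiom.Extensionality.Propositional using (Extensionality)
open import Data.Bool.Base using (Bool; true; false; not)
open import Data.Bool.Properties using (not-¬; ¬-not)
open import Data.Empty using (⊥; ⊥-elim)
open import Data.Fin.Base using (Fin; zero; suc; toℕ; splitAt; _↑ˡ_; _↑ʳ_)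
open import Data.Fin.Properties using (toℕ-injective)
open import Data.Integer.Base as ℤ using (ℤ)
open import Data.Nat.Base using (ℕ; zero; suc; _+_; _*_; _⊔_; _≤_; _<_; s≤s; s≤s⁻¹)
open import Data.Nat.Properties
open import Data.Product.Base using (∃; _×_; _,_; proj₁; proj₂)
open import Data.Product.Function.NonDependent.Propositional using (_×-⇔_)
open import Data.Rational.Base as ℚ using (ℚ; mkℚ; 0ℚ; 1ℚ; -_)
import Data.Rational.Properties as ℚ
open import Data.Sum.Base using (_⊎_; inj₁; inj₂; [_,_]′)
open import Data.Sum.Function.Propositional using (_⊎-⇔_)
open import Data.Unit.Base using (⊤; tt)
open import Data.Vec.Functional using (Vector; []; _∷_; _++_)
open import Data.Vec.Functional.Properties using (lookup-++ˡ; lookup-++ʳ)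
open import Function.Base using (_∘_)
open import Function.Bundles
  using (_⇔_; mk⇔; mk↣; mk↔ₛ′; Injection; Bijection; module Equivalence)
open import Function.Construct.Composition using (_⇔-∘_)
open import Function.Construct.Symmetry using (⇔-sym)
open import Induction.WellFounded using (WellFounded; Acc; acc; module All; module FixPoint)
open import Level using (Level; 0ℓ)
open import Relation.Binary.Bundles using (Setoid)
import Relation.Binary.Construct.On as On
open import Relation.Binary.Core using (Rel)
open import Relation.Binary.Definitions using (Tri; tri<; tri≈; tri>)
open import Relation.Binary.PropositionalEquality
open import Relation.Binary.PropositionalEquality.WithK using () renaming (≡-irrelevant to uip)
open import Relation.Binary.Structures using (IsStrictTotalOrder)
open import Relation.Nullary using (¬_; Dec; yes; no; does; contradiction)
open import Relation.Unary using (Pred; _⊆_; _∩_; ∁)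

-- Both directions pass through `ω₁-Ordered`. Since `ω₁` is a large setoid of well-orders, elements
-- of different well-orders must be compared; their ranks in the type `Ord` of trees provide a
-- common scale, and recursion along `Ord` also well-orders the continuum.
--
-- The second direction has to defeat every ultrafilter at once, principal ones included. Hence
-- bounds are found for all coordinates of a sequence and not merely for a large set of them. The
-- factor ℚ removes every first-order difference between the two orders, while their cofinalities
-- are those of J₁ and J₂. The failure of CH enters where the continuum is shown not to be of size
-- at most ℵ₁: if it were, J₂ would itself be a family of that size without a strict upper bound in
-- J₂.

private variable
  ℓ ℓ₁ ℓ₂ ℓ₃ ℓ₄ : Level

open Equivalence using () renaming (to to ⇒; from to ⇐)

-- Ordinals as well-founded trees

data Ord : Set₁ where
  sup : (A : Set) → (A → Ord) → Ord

infix 4 _≼_ _≺_ _≋_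

-- Quantifies over branching sets only, hence is small although `Ord` is large: the initial segments
-- that a map `A → Ord` induces on a set `A` are ordinary predicates on `A`.
_≼_ : Rel Ord 0ℓ
sup A f ≼ sup B g = ∀ a → ∃ λ b → f a ≼ g b

_≺_ : Rel Ord 0ℓ
α ≺ sup B g = ∃ λ b → α ≼ g b

_≋_ : Rel Ord 0ℓ
α ≋ β = α ≼ β × β ≼ α

≼-refl : ∀ α → α ≼ α
≼-refl (sup A f) a = a , ≼-refl (f a)

≼-trans : ∀ α β γ → α ≼ β → β ≼ γ → α ≼ γ
≼-trans (sup A f) (sup B g) (sup C h) p q a =
  let b , p′ = p a
      c , q′ = q b
  in c , ≼-trans (f a) (g b) (h c) p′ q′

≼-≺-trans : ∀ α β γ → α ≼ β → β ≺ γ → α ≺ γ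
≼-≺-trans α β (sup C h) p (c , q) = c , ≼-trans α β (h c) p q

≺-≼-trans : ∀ α β γ → α ≺ β → β ≼ γ → α ≺ γ
≺-≼-trans α (sup B g) (sup C h) (b , p) q =
  let c , q′ = q b in c , ≼-trans α (g b) (h c) p q′

child-≺ : ∀ {A f} β → sup A f ≼ β → ∀ a → f a ≺ β
child-≺ (sup B g) p = p

sup-≼ : ∀ {A f} β → (∀ a → f a ≺ β) → sup A f ≼ β
sup-≼ (sup B g) p = p

≺⇒≼ : ∀ α β → α ≺ β → α ≼ β
≺⇒≼ (sup A f) (sup B g) (b , p) a = b , ≺⇒≼ (f a) (g b) (child-≺ (g b) p a)

≺-trans : ∀ α β γ → α ≺ β → β ≺ γ → α ≺ γ
≺-trans α β γ p q = ≼-≺-trans α β γ (≺⇒≼ α β p) q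

≺-irrefl : ∀ α → ¬ α ≺ α
≺-irrefl (sup B g) (b , p) = ≺-irrefl (g b) (child-≺ (g b) p b)

≺-wellFounded : WellFounded _≺_
≺-wellFounded β = go β β (≼-refl β)
  where
  -- The recursion is on the bound β: a predecessor γ of α need not be a subtree of α, but it lies
  -- below some child of β.
  go : ∀ β α → α ≼ β → Acc _≺_ α
  go (sup B g) α α≼β = acc λ {γ} γ≺α →
    let b , γ≼gb = ≺-≼-trans γ α (sup B g) γ≺α α≼β in go (g b) γ γ≼gb

≋-sym : ∀ {α β} → α ≋ β → β ≋ α
≋-sym (p , q) = q , p

≋-trans : ∀ α β γ → α ≋ β → β ≋ γ → α ≋ γ
≋-trans α β γ (p , p′) (q , q′) = ≼-trans α β γ p q , ≼-trans γ β α q′ p′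

≺-resp-≋ : ∀ α α′ β β′ → α ≋ α′ → β ≋ β′ → α ≺ β → α′ ≺ β′
≺-resp-≋ α α′ β β′ (_ , α′≼α) (β≼β′ , _) α≺β =
  ≺-≼-trans α′ β β′ (≼-≺-trans α′ α β α′≼α α≺β) β≼β′

-- The rank of an element under a well-founded relation

module Rank {A : Set} {_<_ : Rel A 0ℓ} (wf : WellFounded _<_) where

  rankAcc : ∀ x → Acc _<_ x → Ord
  rankAcc x (acc rs) = sup (∃ λ y → y < x) (λ (y , y<x) → rankAcc y (rs y<x))

  rank : A → Ord
  rank x = rankAcc x (wf x)

  rankAcc-irr : ∀ x p q → rankAcc x p ≼ rankAcc x q
  rankAcc-irr x (acc rs) (acc ss) (y , y<x) =
    (y , y<x) , rankAcc-irr y (rs y<x) (ss y<x)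

  rank-mono : ∀ {x y} → x < y → rank x ≺ rank y
  rank-mono {x} {y} x<y with wf y
  ... | acc rs = (x , x<y) , rankAcc-irr x (wf x) (rs x<y)

  ≺-rank : ∀ {α} y → α ≺ rank y → ∃ λ x → x < y × α ≼ rank x
  ≺-rank {α} y α≺ with wf y
  ... | acc rs = let (x , x<y) , α≼ = α≺ in
    x , x<y , ≼-trans α _ _ α≼ (rankAcc-irr x (rs x<y) (wf x))

  rank-≼ : ∀ {β} y → (∀ x → x < y → rank x ≺ β) → rank y ≼ β
  rank-≼ {sup B g} y below with wf y
  ... | acc rs = λ (x , x<y) →
    let b , x≼b = below x x<y in b , ≼-trans _ _ (g b) (rankAcc-irr x (rs x<y) (wf x)) x≼b

  type : Ord
  type = sup A rank

module _ {A B : Set} {_<_ : Rel A 0ℓ} {_⊏_ : Rel B 0ℓ}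
         (wfA : WellFounded _<_) (wfB : WellFounded _⊏_) (e : A → B)
         (mono : ∀ {x y} → x < y → e x ⊏ e y)
         (initial : ∀ {z y} → z ⊏ e y → ∃ λ x → x < y × e x ≡ z) where
  private
    module A = Rank wfA
    module B = Rank wfB

  -- The image of `e` is an initial segment, so the predecessors of `e y` are exactly the images of
  -- those of `y`, and the two trees match by induction.
  rank-embedding : ∀ x → A.rank x ≋ B.rank (e x)
  rank-embedding x = go x (wfA x)
    where
    go : ∀ y → Acc _<_ y → A.rank y ≋ B.rank (e y)
    go y (acc rs) =
      A.rank-≼ y (λ x x<y →
        ≼-≺-trans (A.rank x) (B.rank (e x)) (B.rank (e y)) (proj₁ (go x (rs x<y))) (B.rank-mono (mono x<y))) ,
      B.rank-≼ (e y) (λ z z⊏ → let x , x<y , ex≡z = initial z⊏ in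
        subst (λ z → B.rank z ≺ A.rank y) ex≡z
          (≼-≺-trans (B.rank (e x)) (A.rank x) (A.rank y) (proj₂ (go x (rs x<y))) (A.rank-mono x<y)))

-- Codes for formulas

<-square : ∀ {m n} k → m < n → m * m + m < n * n + k
<-square {m} {n} k m<n = begin-strict
  m * m + m           ≡⟨ +-comm (m * m) m ⟩
  m + m * m           <⟨ s≤s (m≤n+m (m + m * m) m) ⟩
  suc m + (m + m * m) ≡⟨ cong (suc m +_) (sym (*-suc m m)) ⟩
  suc m * suc m       ≤⟨ *-mono-≤ m<n m<n ⟩
  n * n               ≤⟨ m≤m+n (n * n) k ⟩
  n * n + k           ∎
  where open ≤-Reasoning

abstract
  pair : ℕ → ℕ → ℕ
  pair m n = (m + n) * (m + n) + m

  -- (m + n)² ≤ pair m n < (m + n + 1)²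
  pair-sum-≤ : ∀ m n m′ n′ → pair m n ≡ pair m′ n′ → m + n ≤ m′ + n′
  pair-sum-≤ m n m′ n′ eq = ≮⇒≥ λ s′<s → <-irrefl (sym eq)
    (≤-<-trans (+-monoʳ-≤ ((m′ + n′) * (m′ + n′)) (m≤m+n m′ n′)) (<-square m s′<s))

  pair-injective : ∀ {m n m′ n′} → pair m n ≡ pair m′ n′ → m ≡ m′ × n ≡ n′
  pair-injective {m} {n} {m′} {n′} eq = m≡m′ , +-cancelˡ-≡ m n n′ (trans s≡s′ (cong (_+ n′) (sym m≡m′)))
    where
    s≡s′ : m + n ≡ m′ + n′
    s≡s′ = ≤-antisym (pair-sum-≤ m n m′ n′ eq) (pair-sum-≤ m′ n′ m n (sym eq))
    m≡m′ : m ≡ m′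
    m≡m′ = +-cancelˡ-≡ ((m + n) * (m + n)) m m′ (trans eq (cong (λ s → s * s + m′) (sym s≡s′)))

codeVector : ∀ {n} → Vector ℕ n → ℕ
codeVector {zero}  v = 0
codeVector {suc n} v = pair (v zero) (codeVector (v ∘ suc))

-- Lengths are not coded: wherever this is applied, they already agree, as the arity of one symbol
-- or as a number of parameters coded separately.
codeVector-injective : ∀ {n} (v w : Vector ℕ n) → codeVector v ≡ codeVector w → ∀ k → v k ≡ w k
codeVector-injective {suc n} v w eq zero    = proj₁ (pair-injective eq)
codeVector-injective {suc n} v w eq (suc k) =
  codeVector-injective (v ∘ suc) (w ∘ suc) (proj₂ (pair-injective eq)) k

module Coding {L : Language} (countable : CountableLanguage L)
              (extensionality : Extensionality 0ℓ 0ℓ) where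
  open Language L

  private
    module F = Injection (proj₁ countable)
    module R = Injection (proj₂ countable)

  codeTerm : ∀ {n} → Term L n → ℕ
  codeTerm (var k)    = pair 0 (toℕ k)
  codeTerm (app f ts) = pair 1 (pair (F.to f) (codeVector λ j → codeTerm (ts j)))

  codeTerm-injective : ∀ {n} (s t : Term L n) → codeTerm s ≡ codeTerm t → s ≡ t
  codeTerm-injective (var k) (var l) eq =
    cong var (toℕ-injective (proj₂ (pair-injective eq)))
  codeTerm-injective (var k) (app g us) eq with pair-injective eq
  ... | () , _
  codeTerm-injective (app f ts) (var l) eq with pair-injective eq
  ... | () , _
  codeTerm-injective (app f ts) (app g us) eq
    with f≡g , eq′ ← pair-injective (proj₂ (pair-injective eq))
    with refl ← F.injective f≡g =
      cong (app f) (extensionality λ j → codeTerm-injective (ts j) (us j)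
          (codeVector-injective (λ j → codeTerm (ts j)) (λ j → codeTerm (us j)) eq′ j))

  tag : ∀ {n} → Formula L n → ℕ
  tag (_ ≐ _)    = 0
  tag (atom _ _) = 1
  tag (¬′ _)     = 2
  tag (_ ∧′ _)   = 3
  tag (_ ∨′ _)   = 4
  tag (_ ⇒′ _)   = 5
  tag (∀′ _)     = 6
  tag (∃′ _)     = 7

  mutual
    codeFormula : ∀ {n} → Formula L n → ℕ
    codeFormula φ = pair (tag φ) (codeBody φ)

    codeBody : ∀ {n} → Formula L n → ℕ
    codeBody (s ≐ t)     = pair (codeTerm s) (codeTerm t)
    codeBody (atom R ts) = pair (R.to R) (codeVector λ j → codeTerm (ts j))
    codeBody (¬′ φ)      = codeFormula φ
    codeBody (φ ∧′ ψ)    = pair (codeFormula φ) (codeFormula ψ)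
    codeBody (φ ∨′ ψ)    = pair (codeFormula φ) (codeFormula ψ)
    codeBody (φ ⇒′ ψ)    = pair (codeFormula φ) (codeFormula ψ)
    codeBody (∀′ φ)      = codeFormula φ
    codeBody (∃′ φ)      = codeFormula φ

  mutual
    codeFormula-injective : ∀ {n} (φ ψ : Formula L n) → codeFormula φ ≡ codeFormula ψ → φ ≡ ψ
    codeFormula-injective φ ψ eq =
      let tag-eq , body-eq = pair-injective eq
      in codeBody-injective φ ψ tag-eq body-eq

    codePair-injective : ∀ {n} (φ φ′ ψ ψ′ : Formula L n) (_*_ : Formula L n → Formula L n → Formula L n) →
                         pair (codeFormula φ) (codeFormula φ′) ≡ pair (codeFormula ψ) (codeFormula ψ′) →
                         (φ * φ′) ≡ (ψ * ψ′)
    codePair-injective φ φ′ ψ ψ′ _*_ eq =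
      let eq₁ , eq₂ = pair-injective eq
      in cong₂ _*_ (codeFormula-injective φ ψ eq₁) (codeFormula-injective φ′ ψ′ eq₂)

    -- Matching the equality of tags with `refl` leaves only the diagonal cases.
    codeBody-injective : ∀ {n} (φ ψ : Formula L n) → tag φ ≡ tag ψ → codeBody φ ≡ codeBody ψ → φ ≡ ψ
    codeBody-injective (s ≐ t) (s′ ≐ t′) refl eq =
      let eq₁ , eq₂ = pair-injective eq
      in cong₂ _≐_ (codeTerm-injective s s′ eq₁) (codeTerm-injective t t′ eq₂)
    codeBody-injective (atom R ts) (atom S us) refl eq
      with R≡S , eq′ ← pair-injective eq
      with refl ← R.injective R≡S =
        cong (atom R) (extensionality λ j → codeTerm-injective (ts j) (us j)
          (codeVector-injective (λ j → codeTerm (ts j)) (λ j → codeTerm (us j)) eq′ j))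
    codeBody-injective (¬′ φ)    (¬′ ψ)    refl eq = cong ¬′_ (codeFormula-injective φ ψ eq)
    codeBody-injective (φ ∧′ φ′) (ψ ∧′ ψ′) refl eq = codePair-injective φ φ′ ψ ψ′ _∧′_ eq
    codeBody-injective (φ ∨′ φ′) (ψ ∨′ ψ′) refl eq = codePair-injective φ φ′ ψ ψ′ _∨′_ eq
    codeBody-injective (φ ⇒′ φ′) (ψ ⇒′ ψ′) refl eq = codePair-injective φ φ′ ψ ψ′ _⇒′_ eq
    codeBody-injective (∀′ φ)    (∀′ ψ)    refl eq = cong ∀′ (codeFormula-injective φ ψ eq)
    codeBody-injective (∃′ φ)    (∃′ ψ)    refl eq = cong ∃′ (codeFormula-injective φ ψ eq)

-- Renaming of variables

lift : ∀ {m n} → (Fin m → Fin n) → Fin (suc m) → Fin (suc n)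
lift s = zero ∷ suc ∘ s

renameTerm : ∀ {L m n} → (Fin m → Fin n) → Term L m → Term L n
renameTerm s (var k)    = var (s k)
renameTerm s (app f ts) = app f (λ j → renameTerm s (ts j))

rename : ∀ {L m n} → (Fin m → Fin n) → Formula L m → Formula L n
rename s (t ≐ u)     = renameTerm s t ≐ renameTerm s u
rename s (atom R ts) = atom R (λ j → renameTerm s (ts j))
rename s (¬′ φ)      = ¬′ rename s φ
rename s (φ ∧′ ψ)    = rename s φ ∧′ rename s ψ
rename s (φ ∨′ ψ)    = rename s φ ∨′ rename s ψ
rename s (φ ⇒′ ψ)    = rename s φ ⇒′ rename s ψ
rename s (∀′ φ)      = ∀′ (rename (lift s) φ)
rename s (∃′ φ)      = ∃′ (rename (lift s) φ)

module _ (extensionality : ∀ {a b} → Extensionality a b) {L : Language} (M : Structure L) where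
  open Structure M using (Carrier; _≈_; fun; rel)

  rename-⟦⟧ : ∀ {m n} (s : Fin m → Fin n) (t : Term L m) (ρ : Vector Carrier n) →
              ⟦ M ⟧ (renameTerm s t) ρ ≡ ⟦ M ⟧ t (ρ ∘ s)
  rename-⟦⟧ s (var k)    ρ = refl
  rename-⟦⟧ s (app f ts) ρ = cong (fun f) (extensionality λ j → rename-⟦⟧ s (ts j) ρ)

  -- As an equality of types, and not just an equivalence, this is a congruence at every connective.
  rename-Satisfies : ∀ {m n} (s : Fin m → Fin n) (φ : Formula L m) (ρ : Vector Carrier n) →
                     Satisfies M (rename s φ) ρ ≡ Satisfies M φ (ρ ∘ s)

  rename-binder : ∀ {m n} (s : Fin m → Fin n) (φ : Formula L (suc m)) (ρ : Vector Carrier n) x →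
                  Satisfies M (rename (lift s) φ) (x ∷ ρ) ≡ Satisfies M φ (x ∷ ρ ∘ s)
  rename-binder s φ ρ x = trans (rename-Satisfies (lift s) φ (x ∷ ρ))
    (cong (Satisfies M φ) (extensionality λ { zero → refl ; (suc k) → refl }))

  rename-Satisfies s (t ≐ u)     ρ = cong₂ _≈_ (rename-⟦⟧ s t ρ) (rename-⟦⟧ s u ρ)
  rename-Satisfies s (atom R ts) ρ = cong (rel R) (extensionality λ j → rename-⟦⟧ s (ts j) ρ)
  rename-Satisfies s (¬′ φ)      ρ = cong ¬_ (rename-Satisfies s φ ρ)
  rename-Satisfies s (φ ∧′ ψ)    ρ = cong₂ _×_ (rename-Satisfies s φ ρ) (rename-Satisfies s ψ ρ)
  rename-Satisfies s (φ ∨′ ψ)    ρ = cong₂ _⊎_ (rename-Satisfies s φ ρ) (rename-Satisfies s ψ ρ)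
  rename-Satisfies s (φ ⇒′ ψ)    ρ = cong₂ (λ A B → A → B) (rename-Satisfies s φ ρ) (rename-Satisfies s ψ ρ)
  rename-Satisfies s (∀′ φ)      ρ = cong (λ P → ∀ x → P x) (extensionality (rename-binder s φ ρ))
  rename-Satisfies s (∃′ φ)      ρ = cong ∃ (extensionality (rename-binder s φ ρ))

-- Back-and-forth systems

module BackAndForth {L : Language} (M N : Structure L) where
  open Language L
  private
    module M = Structure M
    module N = Structure N

  module _
    (_~_ : ∀ {n} → Vector M.Carrier n → Vector N.Carrier n → Set)
    (equality : ∀ {n} {ρ : Vector M.Carrier n} {σ : Vector N.Carrier n} → ρ ~ σ → (s t : Term L n) →
                (⟦ M ⟧ s ρ M.≈ ⟦ M ⟧ t ρ) ⇔ (⟦ N ⟧ s σ N.≈ ⟦ N ⟧ t σ))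
    (relation : ∀ {n} {ρ : Vector M.Carrier n} {σ : Vector N.Carrier n} → ρ ~ σ →
                (R : RelSym) (ts : Vector (Term L n) (relArity R)) →
                M.rel R (λ j → ⟦ M ⟧ (ts j) ρ) ⇔ N.rel R (λ j → ⟦ N ⟧ (ts j) σ))
    (forth : ∀ {n} {ρ : Vector M.Carrier n} {σ : Vector N.Carrier n} → ρ ~ σ →
             (x : M.Carrier) → ∃ λ (y : N.Carrier) → (x ∷ ρ) ~ (y ∷ σ))
    (back : ∀ {n} {ρ : Vector M.Carrier n} {σ : Vector N.Carrier n} → ρ ~ σ →
            (y : N.Carrier) → ∃ λ (x : M.Carrier) → (x ∷ ρ) ~ (y ∷ σ))
    where

    -- Serves both for the graph of an isomorphism and for finite partial isomorphisms of dense
    -- orders. The atomic hypotheses speak of arbitrary terms, so `_~_` need not be closed under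
    -- function symbols.
    preserves : ∀ {n} {ρ : Vector M.Carrier n} {σ} → ρ ~ σ → ∀ φ → Satisfies M φ ρ ⇔ Satisfies N φ σ
    preserves ρ~σ (s ≐ t)     = equality ρ~σ s t
    preserves ρ~σ (atom R ts) = relation ρ~σ R ts
    preserves ρ~σ (¬′ φ)      = let e = preserves ρ~σ φ in mk⇔ (_∘ ⇐ e) (_∘ ⇒ e)
    preserves ρ~σ (φ ∧′ ψ)    = preserves ρ~σ φ ×-⇔ preserves ρ~σ ψ
    preserves ρ~σ (φ ∨′ ψ)    = preserves ρ~σ φ ⊎-⇔ preserves ρ~σ ψ
    preserves ρ~σ (φ ⇒′ ψ)    = let d = preserves ρ~σ φ ; e = preserves ρ~σ ψ in
      mk⇔ (λ f → ⇒ e ∘ f ∘ ⇐ d) (λ f → ⇐ e ∘ f ∘ ⇒ d)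
    preserves ρ~σ (∀′ φ)      = mk⇔
      (λ f y → let x , xρ~yσ = back ρ~σ y in ⇒ (preserves xρ~yσ φ) (f x))
      (λ f x → let y , xρ~yσ = forth ρ~σ x in ⇐ (preserves xρ~yσ φ) (f y))
    preserves ρ~σ (∃′ φ)      = mk⇔
      (λ (x , p) → let y , xρ~yσ = forth ρ~σ x in y , ⇒ (preserves xρ~yσ φ) p)
      (λ (y , p) → let x , xρ~yσ = back ρ~σ y in x , ⇐ (preserves xρ~yσ φ) p)

≃⇒≡ₑ : ∀ {L} {M N : Structure L} → M ≃ N → M ≡ₑ N
≃⇒≡ₑ {L} {M} {N} M≃N = BackAndForth.preserves M N _~_ equality relation
  (λ {_} {ρ} {σ} ρ~σ x → to x , λ { zero → N.refl ; (suc k) → ρ~σ k })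
  (λ {_} {ρ} {σ} ρ~σ y → let x , eq = Bijection.surjective bijection y in
    x , λ { zero → eq M.refl ; (suc k) → ρ~σ k })
  (λ ())
  where
  open _≃_ M≃N
  module M = Structure M
  module N = Structure N
  _~_ : ∀ {n} → Vector M.Carrier n → Vector N.Carrier n → Set
  ρ ~ σ = ∀ k → to (ρ k) N.≈ σ k
  term : ∀ {n} {ρ : Vector M.Carrier n} {σ} → ρ ~ σ → ∀ t → to (⟦ M ⟧ t ρ) N.≈ ⟦ N ⟧ t σ
  term ρ~σ (var k)    = ρ~σ k
  term ρ~σ (app f ts) = N.trans (fun-homo f _) (N.fun-cong f λ j → term ρ~σ (ts j))
  equality : ∀ {n} {ρ : Vector M.Carrier n} {σ} → ρ ~ σ → ∀ s t →
             (⟦ M ⟧ s ρ M.≈ ⟦ M ⟧ t ρ) ⇔ (⟦ N ⟧ s σ N.≈ ⟦ N ⟧ t σ)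
  equality ρ~σ s t = mk⇔
    (λ e → N.trans (N.sym (term ρ~σ s)) (N.trans (Bijection.cong bijection e) (term ρ~σ t)))
    (λ e → Bijection.injective bijection (N.trans (term ρ~σ s) (N.trans e (N.sym (term ρ~σ t)))))
  relation : ∀ {n} {ρ : Vector M.Carrier n} {σ} → ρ ~ σ → ∀ R ts →
             M.rel R (λ j → ⟦ M ⟧ (ts j) ρ) ⇔ N.rel R (λ j → ⟦ N ⟧ (ts j) σ)
  relation ρ~σ R ts = mk⇔
    (N.rel-resp R (λ j → term ρ~σ (ts j)) ∘ ⇒ (rel-iso R _))
    (⇐ (rel-iso R _) ∘ N.rel-resp R (λ j → N.sym (term ρ~σ (ts j))))

-- Dense linear orders without endpoints

record DenseOrder : Set₁ where
  infix 4 _⊏_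
  field
    Carrier  : Set
    _⊏_      : Rel Carrier 0ℓ
    point    : Carrier
    ⊏-irrefl : ∀ {x} → ¬ x ⊏ x
    ⊏-trans  : ∀ {x y z} → x ⊏ y → y ⊏ z → x ⊏ z
    ⊏-total  : ∀ x y → x ⊏ y ⊎ x ≡ y ⊎ y ⊏ x
    dense    : ∀ {x y} → x ⊏ y → ∃ λ z → x ⊏ z × z ⊏ y
    above    : ∀ x → ∃ λ y → x ⊏ y
    below    : ∀ x → ∃ λ y → y ⊏ x

orderLanguage : Language
orderLanguage = record { FunSym = ⊥ ; RelSym = ⊤ ; funArity = λ () ; relArity = λ _ → 2 }

orderLanguage-countable : CountableLanguage orderLanguage
orderLanguage-countable = mk↣ {to = λ ()} (λ { {()} }) , mk↣ {to = λ _ → 0} λ _ → refl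

orderStructure : DenseOrder → Structure orderLanguage
orderStructure D = record
  { universe   = setoid Carrier
  ; inhabitant = point
  ; fun        = λ ()
  ; fun-cong   = λ ()
  ; rel        = λ _ xs → xs zero ⊏ xs (suc zero)
  ; rel-resp   = λ _ xs≡ys → subst₂ _⊏_ (xs≡ys zero) (xs≡ys (suc zero))
  }
  where open DenseOrder D

-- Codes for rationals and for pairs of a number and a bit sequence

codeℤ : ℤ → ℕ
codeℤ (ℤ.+ n)      = pair 0 n
codeℤ (ℤ.-[1+ n ]) = pair 1 n

codeℤ-injective : ∀ i j → codeℤ i ≡ codeℤ j → i ≡ j
codeℤ-injective (ℤ.+ m) (ℤ.+ n) eq = cong ℤ.+_ (proj₂ (pair-injective eq))
codeℤ-injective (ℤ.-[1+ m ]) (ℤ.-[1+ n ]) eq = cong ℤ.-[1+_] (proj₂ (pair-injective eq))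
codeℤ-injective (ℤ.+ m) (ℤ.-[1+ n ]) eq with () ← proj₁ (pair-injective eq)
codeℤ-injective (ℤ.-[1+ m ]) (ℤ.+ n) eq with () ← proj₁ (pair-injective eq)

codeℚ : ℚ → ℕ
codeℚ (mkℚ n d _) = pair (codeℤ n) d

codeℚ-injective : ∀ p q → codeℚ p ≡ codeℚ q → p ≡ q
codeℚ-injective (mkℚ n d _) (mkℚ n′ d′ _) eq
  with n-eq , refl ← pair-injective eq
  with refl ← codeℤ-injective n n′ n-eq = refl

-- The sequence x behind m ones and a zero. The first zero shows where x begins, so ω × 2^ω embeds
-- in 2^ω; this bounds the size of J × ℚ.
prefix : ℕ → (ℕ → Bool) → ℕ → Bool
prefix zero    x zero    = false
prefix zero    x (suc k) = x k
prefix (suc m) x zero    = true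
prefix (suc m) x (suc k) = prefix m x k

prefix-injective : ∀ m n {x y} → (∀ k → prefix m x k ≡ prefix n y k) → m ≡ n × ∀ k → x k ≡ y k
prefix-injective zero    zero    eq = refl , eq ∘ suc
prefix-injective zero    (suc n) eq with () ← eq zero
prefix-injective (suc m) zero    eq with () ← eq zero
prefix-injective (suc m) (suc n) eq =
  let m≡n , x≗y = prefix-injective m n (eq ∘ suc) in cong suc m≡n , x≗y

module Classically (classical : Classical) where
  open Classical classical

  -- Excluded middle as a choice operator

  em : (P : Set ℓ₃) → Dec P
  em P = excludedMiddle {P = P}

  byContradiction : {P : Set ℓ₃} → ¬ ¬ P → P
  byContradiction {P = P} ¬¬p with em P
  ... | yes p = p
  ... | no ¬p = ⊥-elim (¬¬p ¬p)

  ¬∀⇒∃¬ : {A : Set ℓ₁} {P : A → Set ℓ₃} → ¬ (∀ x → P x) → ∃ λ x → ¬ P x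
  ¬∀⇒∃¬ ¬∀ = byContradiction λ ¬∃ → ¬∀ λ x → byContradiction λ ¬Px → ¬∃ (x , ¬Px)

  choose : {A : Set ℓ₁} (P : A → Set ℓ₃) → A → A
  choose P d with em (∃ P)
  ... | yes (x , _) = x
  ... | no  _       = d

  choose-spec : {A : Set ℓ₁} (P : A → Set ℓ₃) (d : A) → ∃ P → P (choose P d)
  choose-spec P d ∃P with em (∃ P)
  ... | yes (_ , Px) = Px
  ... | no  ¬∃P      = contradiction ∃P ¬∃P

  decide : Set ℓ₃ → Bool
  decide P = does (em P)

  decide-sound : {P : Set ℓ₃} → decide P ≡ true → P
  decide-sound {P = P} eq with em P
  ... | yes p = p

  decide-complete : {P : Set ℓ₃} → P → decide P ≡ true
  decide-complete {P = P} p with em P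
  ... | yes _ = refl
  ... | no ¬p = contradiction p ¬p

  decide-cong : {P : Set ℓ₃} {Q : Set ℓ₄} → (P → Q) → (Q → P) → decide P ≡ decide Q
  decide-cong {P = P} {Q = Q} f g with em P | em Q
  ... | yes _ | yes _ = refl
  ... | no  _ | no  _ = refl
  ... | yes p | no ¬q = contradiction (f p) ¬q
  ... | no ¬p | yes q = contradiction (g q) ¬p

  -- Suppose no child of α lies above β. A child of α that is not ≺ β would, by comparison with each
  -- child of β, lie strictly above all of these, hence above β.
  ≼-total : ∀ α β → α ≼ β ⊎ β ≺ α
  ≼-total (sup A f) (sup B g) with em (∃ λ a → sup B g ≼ f a)
  ... | yes β≺α = inj₂ β≺α
  ... | no  β⊀α = inj₁ λ a → byContradiction λ fa⊀β →
    β⊀α (a , sup-≼ (f a) λ b → [ (λ fa≼gb → ⊥-elim (fa⊀β (b , fa≼gb))) , (λ gb≺fa → gb≺fa) ]′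
                                 (≼-total (f a) (g b)))

  ≺-cmp : ∀ α β → α ≺ β ⊎ α ≋ β ⊎ β ≺ α
  ≺-cmp α β with ≼-total α β | ≼-total β α
  ... | inj₂ β≺α | _        = inj₂ (inj₂ β≺α)
  ... | inj₁ _   | inj₂ α≺β = inj₁ α≺β
  ... | inj₁ α≼β | inj₁ β≼α = inj₂ (inj₁ (α≼β , β≼α))

  ⊀⇒≽ : ∀ α β → ¬ α ≺ β → β ≼ α
  ⊀⇒≽ α β α⊀β = [ (λ β≼α → β≼α) , (λ α≺β → contradiction α≺β α⊀β) ]′ (≼-total β α)

  -- A general total preorder and a selecting predicate let this yield the largest entry of a tuple
  -- of ordinals as well as both edges of a cut in a dense order.
  maximum : {X : Set ℓ₁} (_≤_ : Rel X ℓ) → (∀ x → x ≤ x) → (∀ {x y z} → x ≤ y → y ≤ z → x ≤ z) →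
            (∀ x y → x ≤ y ⊎ y ≤ x) → ∀ {n} (v : Vector X n) (P : Pred (Fin n) ℓ₃) →
            (∀ k → ¬ P k) ⊎ ∃ λ k → P k × ∀ l → P l → v l ≤ v k
  maximum _≤_ refl′ trans′ total {zero} v P = inj₁ λ ()
  maximum _≤_ refl′ trans′ total {suc n} v P
    with em (P zero) | maximum _≤_ refl′ trans′ total (v ∘ suc) (P ∘ suc)
  ... | no ¬P0 | inj₁ none = inj₁ λ { zero → ¬P0 ; (suc k) → none k }
  ... | yes P0 | inj₁ none =
    inj₂ (zero , P0 , λ { zero _ → refl′ (v zero) ; (suc l) Pl → contradiction Pl (none l) })
  ... | no ¬P0 | inj₂ (k , Pk , k-max) =
    inj₂ (suc k , Pk , λ { zero P0 → contradiction P0 ¬P0 ; (suc l) → k-max l })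
  ... | yes P0 | inj₂ (k , Pk , k-max) with total (v zero) (v (suc k))
  ... | inj₁ 0≤k = inj₂ (suc k , Pk , λ { zero _ → 0≤k ; (suc l) → k-max l })
  ... | inj₂ k≤0 = inj₂ (zero , P0 , λ { zero _ → refl′ (v zero) ; (suc l) Pl → trans′ (k-max l Pl) k≤0 })

  -- Well-founded recursion with G applied to a total function; junk value d outside the
  -- predecessors.

  module Recursion {A : Set ℓ₁} {B : Set ℓ₂} {_<_ : Rel A ℓ} (wf : WellFounded _<_)
                   (d : B) (G : A → (A → B) → B) where

    restrict : ∀ {x} → (∀ {y} → y < x → B) → A → B
    restrict {x} f y with em (y < x)
    ... | yes y<x = f y<x
    ... | no  _   = d

    restrict-< : ∀ {x y} (f : A → B) → y < x → restrict {x} (λ {y} _ → f y) y ≡ f y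
    restrict-< {x} {y} f y<x with em (y < x)
    ... | yes _  = refl
    ... | no y≮x = contradiction y<x y≮x

    solution : A → B
    solution = All.wfRec wf _ (λ _ → B) (λ x IH → G x (restrict IH))

    solution-eq : ∀ x → solution x ≡ G x (restrict {x} (λ {y} _ → solution y))
    solution-eq x = FixPoint.unfold-wfRec wf (λ _ → B) (λ x IH → G x (restrict IH)) ext {x}
      where
      ext : ∀ x {IH IH′ : ∀ {y} → y < x → B} → (∀ {y} y<x → IH {y} y<x ≡ IH′ y<x) →
            G x (restrict IH) ≡ G x (restrict IH′)
      ext x {IH} {IH′} eq = cong (G x) (extensionality lemma)
        where
        lemma : ∀ y → restrict IH y ≡ restrict IH′ y
        lemma y with em (y < x)
        ... | yes y<x = eq y<x
        ... | no  _   = refl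

  -- Zermelo's theorem: a recursion that always picks a new element of A, if there is one, is onto,
  -- since otherwise Ord would inject into A, and the supremum of representatives of the values
  -- would be an ordinal not below itself.

  module Zermelo {A : Set} (d : A) where
    private
      -- `choose` may pick differently for equivalent predicates. Equivalent sets have equal Boolean
      -- characteristic functions, so a choice made from these depends on the set alone; this is why
      -- `h` respects `_≋_`.
      fresh : (A → Bool) → A
      fresh S = choose (λ x → S x ≡ false) d

      module R = Recursion ≺-wellFounded d (λ α g → fresh (λ x → decide (∃ λ β → β ≺ α × g β ≡ x)))

      h : Ord → A
      h = R.solution

      used : Ord → A → Bool
      used α x = decide (∃ λ β → β ≺ α × h β ≡ x)

      h-eq : ∀ α → h α ≡ fresh (used α)
      h-eq α = trans (R.solution-eq α) (cong fresh (extensionality λ x → decide-cong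
        (λ (β , β≺α , eq) → β , β≺α , trans (sym (R.restrict-< h β≺α)) eq)
        (λ (β , β≺α , eq) → β , β≺α , trans (R.restrict-< h β≺α) eq)))

      h-resp : ∀ {α β} → α ≋ β → h α ≡ h β
      h-resp {α} {β} (α≼β , β≼α) = trans (h-eq α) (trans (cong fresh (extensionality λ x → decide-cong
        (λ (γ , γ≺α , eq) → γ , ≺-≼-trans γ α β γ≺α α≼β , eq)
        (λ (γ , γ≺β , eq) → γ , ≺-≼-trans γ β α γ≺β β≼α , eq))) (sym (h-eq β)))

      h-fresh : ∀ {α β} x → used α x ≡ false → β ≺ α → h β ≢ h α
      h-fresh {α} {β} x x∉ β≺α eq
        with trans (sym (decide-complete (β , β≺α , trans eq (h-eq α))))
                   (choose-spec (λ x → used α x ≡ false) d (x , x∉))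
      ... | ()

      h-surjective : ∀ x → ∃ λ α → h α ≡ x
      h-surjective x = byContradiction λ x∉h →
        -- Being a value of `h` is a large statement, as it quantifies over `Ord`; its Boolean truth
        -- value is small enough to index the children of a tree.
        let Ω = sup (∃ λ y → decide (∃ λ α → h α ≡ y) ≡ true) (λ (_ , y∈h) → proj₁ (decide-sound y∈h))
            hΩ∈h = decide-complete (Ω , refl)
        in h-fresh x (unused x∉h Ω) ((h Ω , hΩ∈h) , ≼-refl _) (proj₂ (decide-sound hΩ∈h))
        where
        unused : ¬ (∃ λ α → h α ≡ x) → ∀ α → used α x ≡ false
        unused x∉h α with em (∃ λ β → β ≺ α × h β ≡ x)
        ... | yes (β , _ , eq) = contradiction (β , eq) x∉h
        ... | no _             = refl

    position : A → Ord
    position x = proj₁ (h-surjective x)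

    position-injective : ∀ {x y} → position x ≋ position y → x ≡ y
    position-injective {x} {y} x≋y =
      trans (sym (proj₂ (h-surjective x))) (trans (h-resp x≋y) (proj₂ (h-surjective y)))

  -- Countable sets, and well-orderings given by ordinal values

  Countable : {A : Set} → Pred A 0ℓ → Set
  Countable {A} P = ∃ λ (f : A → ℕ) → ∀ {x y} → P x → P y → f x ≡ f y → x ≡ y

  countable-⊆ : {A : Set} {P Q : Pred A 0ℓ} → P ⊆ Q → Countable Q → Countable P
  countable-⊆ P⊆Q (f , f-inj) = f , λ Px Py → f-inj (P⊆Q Px) (P⊆Q Py)

  continuum-uncountable : ¬ Countable {ℕ → Bool} (λ _ → ⊤)
  continuum-uncountable (f , f-injective) =
    not-¬ refl (cong (λ x → x (f diagonal)) (f-injective tt tt f-decode))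
    where
    decode : ℕ → ℕ → Bool
    decode n = choose (λ x → f x ≡ n) (λ _ → true)
    diagonal : ℕ → Bool
    diagonal n = not (decode n n)
    f-decode : f (decode (f diagonal)) ≡ f diagonal
    f-decode = choose-spec (λ x → f x ≡ f diagonal) (λ _ → true) (diagonal , refl)

  module RankHit {A : Set} {_<_ : Rel A 0ℓ} (wf : WellFounded _<_) where
    open Rank wf public

    -- As long as α ≺ `rank y`, some predecessor of y still has a rank at least α; by
    -- well-foundedness the descent ends at an exact hit. The ranks thus leave no gaps.
    ≼-rank : ∀ {α} y → α ≼ rank y → ∃ λ x → rank x ≋ α
    ≼-rank {α} y = go y (wf y)
      where
      go : ∀ y → Acc _<_ y → α ≼ rank y → ∃ λ x → rank x ≋ α
      go y (acc rs) α≼y with ≼-total (rank y) α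
      ... | inj₁ y≼α = y , y≼α , α≼y
      ... | inj₂ α≺y = let x , x<y , α≼x = ≺-rank y α≺y in go x (rs x<y) α≼x

    ≺-type : ∀ {α} → α ≺ type → ∃ λ x → rank x ≋ α
    ≺-type (y , α≼y) = ≼-rank y α≼y

    rank-≺-type : ∀ x → rank x ≺ type
    rank-≺-type x = x , ≼-refl _

    module _ (total : ∀ x y → x < y ⊎ x ≡ y ⊎ y < x) where

      rank-reflects : ∀ {x y} → rank x ≺ rank y → x < y
      rank-reflects {x} {y} rx≺ry with total x y
      ... | inj₁ x<y         = x<y
      ... | inj₂ (inj₁ refl) = contradiction rx≺ry (≺-irrefl _)
      ... | inj₂ (inj₂ y<x)  = contradiction (≺-trans _ _ _ rx≺ry (rank-mono y<x)) (≺-irrefl _)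

      rank-injective : ∀ {x y} → rank x ≋ rank y → x ≡ y
      rank-injective {x} {y} (rx≼ry , ry≼rx) with total x y
      ... | inj₁ x<y         = contradiction (≺-≼-trans _ _ _ (rank-mono x<y) ry≼rx) (≺-irrefl _)
      ... | inj₂ (inj₁ x≡y)  = x≡y
      ... | inj₂ (inj₂ y<x)  = contradiction (≺-≼-trans _ _ _ (rank-mono y<x) rx≼ry) (≺-irrefl _)

  module WellOrdered {A : Set} (r : A → Ord) (r-injective : ∀ {x y} → r x ≋ r y → x ≡ y) where
    infix 4 _◂_

    _◂_ : Rel A 0ℓ
    x ◂ y = r x ≺ r y

    ◂-wellFounded : WellFounded _◂_
    ◂-wellFounded = On.wellFounded r ≺-wellFounded

    ◂-trans : ∀ {x y z} → x ◂ y → y ◂ z → x ◂ z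
    ◂-trans {x} {y} {z} = ≺-trans (r x) (r y) (r z)

    ◂-irrefl : ∀ {x} → ¬ x ◂ x
    ◂-irrefl {x} = ≺-irrefl (r x)

    ◂-total : ∀ x y → x ◂ y ⊎ x ≡ y ⊎ y ◂ x
    ◂-total x y with ≺-cmp (r x) (r y)
    ... | inj₁ x◂y        = inj₁ x◂y
    ... | inj₂ (inj₁ x≋y) = inj₂ (inj₁ (r-injective x≋y))
    ... | inj₂ (inj₂ y◂x) = inj₂ (inj₂ y◂x)

    ≼⇒≡⊎◂ : ∀ {x y} → r x ≼ r y → x ≡ y ⊎ x ◂ y
    ≼⇒≡⊎◂ {x} {y} x≼y with ◂-total x y
    ... | inj₁ x◂y        = inj₂ x◂y
    ... | inj₂ (inj₁ x≡y) = inj₁ x≡y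
    ... | inj₂ (inj₂ y◂x) = contradiction (≺-≼-trans (r y) (r x) (r y) y◂x x≼y) (◂-irrefl {y})

    least : (P : Pred A ℓ₃) → ∃ P → ∃ λ x → P x × ∀ y → y ◂ x → ¬ P y
    least P (x , Px) = go x (◂-wellFounded x) Px
      where
      go : ∀ x → Acc _◂_ x → P x → ∃ λ x → P x × ∀ y → y ◂ x → ¬ P y
      go x (acc rs) Px with em (∃ λ y → y ◂ x × P y)
      ... | yes (y , y◂x , Py) = go y (rs y◂x) Py
      ... | no  minimal        = x , Px , λ y y◂x Py → minimal (y , y◂x , Py)

    -- A property of finite tuples that can be extended by each i, given that it holds for the
    -- tuples below i, holds everywhere: induct on the largest entry.

    module FiniteCharacter
      (Φ : ∀ {n} → Vector A n → Set)
      (empty : Φ {0} [])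
      (reindex : ∀ {m n} (w : Vector A m) (s : Fin n → Fin m) → Φ w → Φ (w ∘ s))
      (step : ∀ i → (∀ {n} (w : Vector A n) → (∀ k → w k ◂ i) → Φ w) →
              ∀ {n} (w : Vector A n) → (∀ k → w k ◂ i) → Φ (i ∷ w))
      where

      private
        UpTo : A → Set
        UpTo i = ∀ {n} (w : Vector A n) → (∀ k → r (w k) ≼ r i) → Φ w

        fromMaximum : ∀ {n} (v : Vector A n) → (∀ k → UpTo (v k)) → Φ v
        fromMaximum v upTo
          with maximum _≼_ ≼-refl (λ {α} {β} {γ} → ≼-trans α β γ)
                 (λ α β → [ inj₁ , (λ β≺α → inj₂ (≺⇒≼ β α β≺α)) ]′ (≼-total α β)) (r ∘ v) (λ _ → ⊤)
        ... | inj₂ (k , _ , k-max) = upTo k v λ l → k-max l tt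
        fromMaximum {zero} v upTo | inj₁ none = subst Φ (extensionality λ ()) empty
        fromMaximum {suc n} v upTo | inj₁ none = contradiction tt (none zero)

        -- The entry i may occur in v repeatedly or not at all. Here w keeps the entries strictly
        -- below i, and s restores the original tuple from `i ∷ w`; this is what `reindex` is for.
        factor : ∀ i {n} (v : Vector A n) → (∀ k → r (v k) ≼ r i) →
                 ∃ λ m → ∃ λ (w : Vector A m) → (∀ k → w k ◂ i) ×
                 ∃ λ (s : Fin n → Fin (suc m)) → ∀ k → (i ∷ w) (s k) ≡ v k
        factor i {zero} v v≼i = 0 , [] , (λ ()) , (λ ()) , λ ()
        factor i {suc n} v v≼i with factor i (v ∘ suc) (v≼i ∘ suc) | ≼⇒≡⊎◂ (v≼i zero)
        ... | m , w , w◂i , s , s-eq | inj₁ v0≡i =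
          m , w , w◂i , zero ∷ s , λ { zero → sym v0≡i ; (suc k) → s-eq k }
        ... | m , w , w◂i , s , s-eq | inj₂ v0◂i =
          suc m , v zero ∷ w , (λ { zero → v0◂i ; (suc k) → w◂i k }) ,
          suc zero ∷ skip ∘ s , λ { zero → refl ; (suc k) → trans (skip-eq (s k)) (s-eq k) }
          where
          skip : Fin (suc m) → Fin (suc (suc m))
          skip zero    = zero
          skip (suc k) = suc (suc k)
          skip-eq : ∀ k → (i ∷ v zero ∷ w) (skip k) ≡ (i ∷ w) k
          skip-eq zero    = refl
          skip-eq (suc k) = refl

        upTo : ∀ i → Acc _◂_ i → UpTo i
        upTo i (acc rs) v v≼i =
          let m , w , w◂i , s , s-eq = factor i v v≼i in
          subst Φ (extensionality s-eq)
            (reindex (i ∷ w) s (step i (λ w w◂i → fromMaximum w λ k → upTo (w k) (rs (w◂i k))) w w◂i))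

      all-tuples : ∀ {n} (v : Vector A n) → Φ v
      all-tuples v = fromMaximum v λ k → upTo (v k) (◂-wellFounded (v k))

  -- The continuum hypothesis as a well-ordering of the continuum

  ω₁-Ordered : (A : Set) → Set₁
  ω₁-Ordered A = ∃ λ (r : A → Ord) → (∀ {x y} → r x ≋ r y → x ≡ y) × ∀ x → Countable (λ y → r y ≺ r x)

  module _ (α : CountableOrdinal) where
    open CountableOrdinal α using (isStrictTotalOrder; wellFounded) renaming (_<_ to _⊏_)

    orderType : Ord
    orderType = RankHit.type wellFounded

    ordinal-total : ∀ x y → x ⊏ y ⊎ x ≡ y ⊎ y ⊏ x
    ordinal-total x y with IsStrictTotalOrder.compare isStrictTotalOrder x y
    ... | tri< x⊏y _ _ = inj₁ x⊏y
    ... | tri≈ _ x≡y _ = inj₂ (inj₁ x≡y)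
    ... | tri> _ _ y⊏x = inj₂ (inj₂ y⊏x)

  module _ {α β : CountableOrdinal} where
    private
      module α = CountableOrdinal α
      module β = CountableOrdinal β
      module Rα = RankHit α.wellFounded
      module Rβ = RankHit β.wellFounded

    -- Elements of equal rank correspond: every rank is below the common order type, hence attained
    -- on the other side, and in a linear order it is attained only once.
    orderType-injective : orderType α ≋ orderType β → α ≅ᵒ β
    orderType-injective (α≼β , β≼α) = record
      { bijection = mk↔ₛ′ (proj₁ ∘ there) (proj₁ ∘ back)
          (λ y → Rβ.rank-injective (ordinal-total β)
            (≋-trans _ _ _ (proj₂ (there _)) (proj₂ (back y))))
          (λ x → Rα.rank-injective (ordinal-total α)
            (≋-trans _ _ _ (proj₂ (back _)) (proj₂ (there x))))
      ; order = λ {x} {y} → mk⇔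
          (λ x<y → Rβ.rank-reflects (ordinal-total β)
            (≺-resp-≋ _ _ _ _ (≋-sym (proj₂ (there x))) (≋-sym (proj₂ (there y))) (Rα.rank-mono x<y)))
          (λ x<y → Rα.rank-reflects (ordinal-total α)
            (≺-resp-≋ _ _ _ _ (proj₂ (there x)) (proj₂ (there y)) (Rβ.rank-mono x<y)))
      }
      where
      there : ∀ x → ∃ λ y → Rβ.rank y ≋ Rα.rank x
      there x = Rβ.≺-type (≺-≼-trans _ _ _ (Rα.rank-≺-type x) α≼β)
      back : ∀ y → ∃ λ x → Rα.rank x ≋ Rβ.rank y
      back y = Rα.≺-type (≺-≼-trans _ _ _ (Rβ.rank-≺-type y) β≼α)

    orderType-≼ : α ≅ᵒ β → orderType α ≼ orderType β
    orderType-≼ α≅β x = to x , proj₁ (rank-embedding α.wellFounded β.wellFounded to (⇒ order) initial x)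
      where
      open _≅ᵒ_ α≅β
      initial : ∀ {z y} → z β.< to y → ∃ λ x → x α.< y × to x ≡ z
      initial {z} {y} z<y =
        from z , ⇐ order (subst (β._< to y) (sym (strictlyInverseˡ z)) z<y) , strictlyInverseˡ z

  -- If y comes before x, the order type of `to y` is the rank of some element of the countable
  -- well-order `to x`, and the number of that element serves as the number of y.
  CH⇒ω₁-ordered : ContinuumHypothesis → ω₁-Ordered (ℕ → Bool)
  CH⇒ω₁-ordered CH = orderType ∘ to , (λ e → extensionality (injective (orderType-injective e))) , segment
    where
    open Bijection CH
    segment : ∀ x → Countable (λ y → orderType (to y) ≺ orderType (to x))
    segment x = (λ y → choose (Index y) 0) , λ {y} {z} y≺x z≺x eq →
      let a , a≡ , a≋y = index y≺x
          b , b≡ , b≋z = index z≺x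
          a≡b = Injection.injective countable (trans a≡ (trans eq (sym b≡)))
      in extensionality (injective (orderType-injective
           (≋-trans _ _ _ (≋-sym a≋y) (subst (λ b → rank b ≋ _) (sym a≡b) b≋z))))
      where
      open CountableOrdinal (to x) using (countable; wellFounded)
      open RankHit wellFounded
      Index : (ℕ → Bool) → ℕ → Set
      Index y n = ∃ λ a → Injection.to countable a ≡ n × rank a ≋ orderType (to y)
      index : ∀ {y} → orderType (to y) ≺ orderType (to x) → Index y (choose (Index y) 0)
      index {y} y≺x = choose-spec (Index y) 0 (let a , a≋y = ≺-type y≺x in _ , a , refl , a≋y)

  -- The bijection sends x to its initial segment, whose order type is the rank of x. It is onto
  -- because a countable ordinal above all ranks would give a numbering of the continuum.
  ω₁-ordered⇒CH : ω₁-Ordered (ℕ → Bool) → ContinuumHypothesis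
  ω₁-ordered⇒CH (r , r-injective , segment-countable) = record
    { to        = initial
    ; cong      = λ x≗y → subst (λ z → initial _ ≅ᵒ initial z) (extensionality x≗y) ≅ᵒ-refl
    ; bijective = (λ e x → cong (λ f → f x) (initial-injective e)) , surjective
    }
    where
    open WellOrdered r r-injective
    -- The values of `r` may skip ordinals, which would spoil surjectivity; ranks under `_◂_` do
    -- not.
    open RankHit ◂-wellFounded using (rank; rank-mono; rank-injective)

    initial : (ℕ → Bool) → CountableOrdinal
    initial x = record
      -- A proof of `y ◂ x` as second component could make several elements out of one y; proofs of
      -- an equality of Booleans are unique.
      { Carrier            = ∃ λ y → decide (y ◂ x) ≡ true
      ; _<_                = λ (y , _) (z , _) → y ◂ z
      ; isStrictTotalOrder = record
        { isStrictPartialOrder = record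
          { isEquivalence = isEquivalence
          ; irrefl        = λ { refl → ◂-irrefl }
          ; trans         = λ {(x , _)} {(y , _)} {(z , _)} → ◂-trans {x} {y} {z}
          ; <-resp-≈      = (λ { refl p → p }) , λ { refl p → p }
          }
        ; compare = compare
        }
      ; wellFounded = On.wellFounded proj₁ ◂-wellFounded
      ; countable   = mk↣ {to = λ (y , _) → proj₁ (segment-countable x) y} λ {(y , y◂x)} {(z , z◂x)} eq →
          element-≡ (proj₂ (segment-countable x) (decide-sound y◂x) (decide-sound z◂x) eq)
      }
      where
      element-≡ : {u v : ∃ λ y → decide (y ◂ x) ≡ true} → proj₁ u ≡ proj₁ v → u ≡ v
      element-≡ {y , p} {.y , q} refl = cong (y ,_) (uip p q)
      compare : (u v : ∃ λ y → decide (y ◂ x) ≡ true) → Tri (proj₁ u ◂ proj₁ v) (u ≡ v) (proj₁ v ◂ proj₁ u)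
      compare (y , p) (z , q) with ◂-total y z
      ... | inj₁ y◂z         = tri< y◂z (λ { refl → ◂-irrefl {y} y◂z })
                                    (λ z◂y → ◂-irrefl {y} (◂-trans {y} {z} {y} y◂z z◂y))
      ... | inj₂ (inj₁ y≡z)  = tri≈ (λ y◂z → ◂-irrefl {z} (subst (_◂ z) y≡z y◂z)) (element-≡ y≡z)
                                    (λ z◂y → ◂-irrefl {z} (subst (z ◂_) y≡z z◂y))
      ... | inj₂ (inj₂ z◂y)  = tri> (λ y◂z → ◂-irrefl {y} (◂-trans {y} {z} {y} y◂z z◂y))
                                    (λ { refl → ◂-irrefl {y} z◂y }) z◂y

    module Initial (x : ℕ → Bool) = RankHit (CountableOrdinal.wellFounded (initial x))

    initial-rank : ∀ x u → Initial.rank x u ≋ rank (proj₁ u)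
    initial-rank x = rank-embedding (CountableOrdinal.wellFounded (initial x)) ◂-wellFounded proj₁ (λ p → p)
      λ {z} {(y , y◂x)} z◂y →
        (z , decide-complete (◂-trans {z} {y} {x} z◂y (decide-sound y◂x))) , z◂y , refl

    orderType-initial : ∀ x → orderType (initial x) ≋ rank x
    orderType-initial x =
      sup-≼ (rank x) (λ u → ≼-≺-trans _ _ (rank x) (proj₁ (initial-rank x u)) (rank-mono (decide-sound (proj₂ u)))) ,
      Rank.rank-≼ ◂-wellFounded x λ y y◂x →
        let u = y , decide-complete y◂x in u , proj₂ (initial-rank x u)

    initial-injective : ∀ {x y} → initial x ≅ᵒ initial y → x ≡ y
    initial-injective {x} {y} e = rank-injective ◂-total
      (≋-trans _ _ _ (≋-sym (orderType-initial x))
        (≋-trans _ _ _ (orderType-≼ e , orderType-≼ (≅ᵒ-sym e)) (orderType-initial y)))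

    surjective : ∀ α → ∃ λ x → ∀ {y} → (∀ n → y n ≡ x n) → initial y ≅ᵒ α
    surjective α with em (∃ λ x → orderType α ≼ rank x)
    ... | yes (x , α≼x) =
      let y , y≋α = RankHit.≼-rank ◂-wellFounded x α≼x in
      y , λ z≗y → subst (λ z → initial z ≅ᵒ α) (sym (extensionality z≗y))
        (orderType-injective (≋-trans _ _ _ (orderType-initial y) y≋α))
    ... | no unbounded = contradiction (index , λ {x} {y} _ _ → index-injective) continuum-uncountable
      where
      open CountableOrdinal α using (Carrier; countable; wellFounded)
      module Rα = RankHit wellFounded
      match : ∀ x → ∃ λ a → Rα.rank a ≋ rank x
      match x with ≼-total (orderType α) (rank x)
      ... | inj₁ α≼x = contradiction (x , α≼x) unbounded
      ... | inj₂ x≺α = Rα.≺-type x≺α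
      index : (ℕ → Bool) → ℕ
      index x = Injection.to countable (proj₁ (match x))
      index-injective : ∀ {x y} → index x ≡ index y → x ≡ y
      index-injective {x} {y} eq = rank-injective ◂-total
        (≋-trans _ _ _ (≋-sym (proj₂ (match x)))
          (subst (λ a → Rα.rank a ≋ rank y) (sym (Injection.injective countable eq)) (proj₂ (match y))))

  -- Nonprincipal ultrafilters

  ++-all : {A : Set} {P : Pred A 0ℓ} {m n : ℕ} (v : Vector A m) (w : Vector A n) →
           (∀ k → P (v k)) → (∀ k → P (w k)) → ∀ k → P ((v ++ w) k)
  ++-all {m = m} v w Pv Pw k with splitAt m k
  ... | inj₁ k = Pv k
  ... | inj₂ k = Pw k

  module _ (r : (ℕ → Bool) → Ord) (r-injective : ∀ {x y} → r x ≋ r y → x ≡ y) where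
    open WellOrdered r r-injective

    private
      Infinite : Pred (Pred ℕ 0ℓ) 0ℓ
      Infinite P = ∀ m → ∃ λ n → m ≤ n × P n

      -- A greedy decision: X becomes large unless it has a finite intersection with some finite
      -- combination of the earlier sets or their complements. Asking for infinite intersections,
      -- not just nonempty ones, keeps the ultrafilter nonprincipal.
      Compatible : ((ℕ → Bool) → Bool) → Pred (ℕ → Bool) 0ℓ
      Compatible U X = ∀ {m} (w : Vector (ℕ → Bool) m) → (∀ k → w k ◂ X) →
                       Infinite (λ n → X n ≡ true × ∀ k → w k n ≡ U (w k))

      module R = Recursion ◂-wellFounded false (λ X U → decide (Compatible U X))

      U : (ℕ → Bool) → Bool
      U = R.solution

      -- For each entry X of w, n lies in X if X is large and in its complement otherwise.
      Agrees : ∀ {m} → Vector (ℕ → Bool) m → Pred ℕ 0ℓ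
      Agrees w n = ∀ k → w k n ≡ U (w k)

      U-eq : ∀ X → U X ≡ decide (Compatible U X)
      U-eq X = trans (R.solution-eq X) (decide-cong
        (λ C w w◂X m → let n , m≤n , Xn , eq = C w w◂X m in
          n , m≤n , Xn , λ k → trans (eq k) (R.restrict-< U (w◂X k)))
        (λ C w w◂X m → let n , m≤n , Xn , eq = C w w◂X m in
          n , m≤n , Xn , λ k → trans (eq k) (sym (R.restrict-< U (w◂X k)))))

      step : ∀ X → (∀ {m} (w : Vector (ℕ → Bool) m) → (∀ k → w k ◂ X) → Infinite (Agrees w)) →
             ∀ {m} (w : Vector (ℕ → Bool) m) → (∀ k → w k ◂ X) → Infinite (Agrees (X ∷ w))
      step X below w w◂X m with em (Compatible U X)
      ... | yes C = let n , m≤n , Xn , eq = C w w◂X m in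
        n , m≤n , λ { zero → trans Xn (sym (trans (U-eq X) (decide-complete C))) ; (suc k) → eq k }
      -- X was rejected because of some `w₁` and a bound m′ beyond which no point agreeing with `w₁`
      -- lies in X. Beyond both bounds, a point agreeing with `w₁` and w together is therefore
      -- outside X.
      ... | no ¬C = byContradiction λ none → ¬C λ {m₁} w₁ w₁◂X m′ → byContradiction λ none₁ →
        let n , max≤n , eq = below (w₁ ++ w) (++-all {P = _◂ X} w₁ w w₁◂X w◂X) (m ⊔ m′)
            eq₁ = λ k → subst (λ Y → Y n ≡ U Y) (lookup-++ˡ w₁ w k) (eq (k ↑ˡ _))
            eq₂ = λ k → subst (λ Y → Y n ≡ U Y) (lookup-++ʳ w₁ w k) (eq (m₁ ↑ʳ k))
            Xn≡false = ¬-not λ Xn → none₁ (n , ≤-trans (m≤n⊔m m m′) max≤n , Xn , eq₁)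
        in none (n , ≤-trans (m≤m⊔n m m′) max≤n , λ
          { zero    → trans Xn≡false (sym (trans (U-eq X) (¬-not (¬C ∘ decide-sound))))
          ; (suc k) → eq₂ k })

      agreeing : ∀ {m} (w : Vector (ℕ → Bool) m) → Infinite (Agrees w)
      agreeing = FiniteCharacter.all-tuples (λ w → Infinite (Agrees w))
        (λ m → m , ≤-refl , λ ())
        (λ w s inf m → let n , m≤n , eq = inf m in n , m≤n , eq ∘ s)
        step

      Large : Pred (Pred ℕ 0ℓ) 0ℓ
      Large P = U (λ n → decide (P n)) ≡ true

      -- At a single n ≥ m that agrees with `U` on P, Q and R at once, membership and largeness
      -- coincide. The filter laws use m = 0; a general m gives the largeness of the cofinite sets.
      large : {P Q : Pred ℕ 0ℓ} (R : Pred ℕ 0ℓ) → Large P → Large Q →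
              (∃ λ m → ∀ n → m ≤ n → P n → Q n → R n) → Large R
      large {P} {Q} R LP LQ (m , imp) =
        let n , m≤n , eq = agreeing ((λ n → decide (P n)) ∷ (λ n → decide (Q n)) ∷ (λ n → decide (R n)) ∷ []) m
            Pn = decide-sound (trans (eq zero) LP)
            Qn = decide-sound (trans (eq (suc zero)) LQ)
        in trans (sym (eq (suc (suc zero)))) (decide-complete (imp n m≤n Pn Qn))

      full : Large (λ _ → ⊤)
      full = let n , _ , eq = agreeing ((λ n → decide ⊤) ∷ []) 0
        in trans (sym (eq zero)) (decide-complete tt)

    nonprincipal : ∃ λ (𝒰 : Ultrafilter ℕ) → ∀ m → Ultrafilter.Large 𝒰 (m ≤_)
    nonprincipal = record
      { Large        = Large
      ; full         = full
      ; proper       = λ L∅ → let n , _ , eq = agreeing ((λ n → decide ⊥) ∷ []) 0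
                              in decide-sound (trans (eq zero) L∅)
      ; upward       = λ {X} {Y} X⊆Y LX → large Y LX LX (0 , λ n _ Xn _ → X⊆Y Xn)
      ; intersection = λ {X} {Y} LX LY → large (X ∩ Y) LX LY (0 , λ n _ Xn Yn → Xn , Yn)
      ; ultra        = ultra
      } , λ m → large (m ≤_) full full (m , λ n m≤n _ _ → m≤n)
      where
      ultra : ∀ X → Large X ⊎ Large (∁ X)
      ultra X with em (Large X)
      ... | yes LX = inj₁ LX
      ... | no ¬LX =
        let n , _ , eq = agreeing ((λ n → decide (X n)) ∷ (λ n → decide (¬ X n)) ∷ []) 0
            n∉X = λ Xn → ¬LX (trans (sym (eq zero)) (decide-complete Xn))
        in inj₂ (trans (sym (eq (suc zero))) (decide-complete n∉X))

  -- Łoś's theorem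

  module Łoś {L : Language} (M : Structure L) (𝒰 : Ultrafilter ℕ) where
    open Ultrafilter 𝒰
    private
      module M = Structure M
      M* = ultrapower M 𝒰
      module M* = Structure M*

    at : ∀ {n} → ℕ → Vector M*.Carrier n → Vector M.Carrier n
    at i ρ k = ρ k i

    at-∷ : ∀ {n} (x : M*.Carrier) (ρ : Vector M*.Carrier n) i → at i (x ∷ ρ) ≡ x i ∷ at i ρ
    at-∷ x ρ i = extensionality λ { zero → refl ; (suc k) → refl }

    term : ∀ {n} (t : Term L n) ρ i → ⟦ M* ⟧ t ρ i ≡ ⟦ M ⟧ t (at i ρ)
    term (var k)    ρ i = refl
    term (app f ts) ρ i = cong (M.fun f) (extensionality λ j → term (ts j) ρ i)

    largeEquiv : {P Q : Pred ℕ 0ℓ} → (∀ i → P i ≡ Q i) → Large P ⇔ Large Q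
    largeEquiv eq = mk⇔ (upward λ {i} → subst (λ A → A) (eq i)) (upward λ {i} → subst (λ A → A) (sym (eq i)))

    large-¬ : {P : Pred ℕ 0ℓ} → (¬ Large P) ⇔ Large (∁ P)
    large-¬ {P} = mk⇔ (λ ¬LP → [ (λ LP → contradiction LP ¬LP) , (λ L∁P → L∁P) ]′ (ultra P))
                      (λ L∁P LP → proper (upward (λ (¬p , p) → ¬p p) (intersection L∁P LP)))

    theorem : ∀ {n} (φ : Formula L n) ρ → Satisfies M* φ ρ ⇔ Large (λ i → Satisfies M φ (at i ρ))
    theorem (s ≐ t)     ρ = largeEquiv λ i → cong₂ M._≈_ (term s ρ i) (term t ρ i)
    theorem (atom R ts) ρ = largeEquiv λ i → cong (M.rel R) (extensionality λ j → term (ts j) ρ i)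
    theorem (¬′ φ)      ρ = let e = theorem φ ρ in large-¬ ⇔-∘ mk⇔ (_∘ ⇐ e) (_∘ ⇒ e)
    theorem (φ ∧′ ψ)    ρ = mk⇔ (λ (p , q) → intersection p q)
                                 (λ pq → upward proj₁ pq , upward proj₂ pq)
                            ⇔-∘ (theorem φ ρ ×-⇔ theorem ψ ρ)
    theorem (φ ∨′ ψ)    ρ = let d = theorem φ ρ ; e = theorem ψ ρ in mk⇔
      [ upward inj₁ ∘ ⇒ d , upward inj₂ ∘ ⇒ e ]′
      (λ pq → [ inj₁ ∘ ⇐ d
              , (λ ¬p → inj₂ (⇐ e (upward (λ { (inj₁ p , ¬p) → contradiction p ¬p ; (inj₂ q , _) → q })
                                          (intersection pq ¬p)))) ]′ (ultra _))
    theorem (φ ⇒′ ψ)    ρ = let d = theorem φ ρ ; e = theorem ψ ρ in mk⇔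
      (λ f → [ (λ p → upward (λ q _ → q) (⇒ e (f (⇐ d p)))) , upward (λ ¬p p → contradiction p ¬p) ]′ (ultra _))
      (λ pq p → ⇐ e (upward (λ (f , p) → f p) (intersection pq (⇒ d p))))
    theorem (∀′ φ)      ρ = mk⇔
      (λ all → byContradiction λ ¬L →
        -- A counterexample at every index that has one, and `M.inhabitant` elsewhere: if the
        -- universal statement failed on a large set, this one sequence would violate it in `M*`.
        let counter = λ i → choose (λ x → ¬ Satisfies M φ (x ∷ at i ρ)) M.inhabitant
        in proper (upward (λ {i} (¬all , p) →
             choose-spec (λ x → ¬ Satisfies M φ (x ∷ at i ρ)) M.inhabitant (¬∀⇒∃¬ ¬all)
                         (subst (Satisfies M φ) (at-∷ counter ρ i) p))
             (intersection (⇒ large-¬ ¬L) (⇒ (theorem φ (counter ∷ ρ)) (all counter)))))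
      (λ L x → ⇐ (theorem φ (x ∷ ρ))
        (upward (λ {i} all → subst (Satisfies M φ) (sym (at-∷ x ρ i)) (all (x i))) L))
    theorem (∃′ φ)      ρ = mk⇔
      (λ (x , p) → upward (λ {i} p → x i , subst (Satisfies M φ) (at-∷ x ρ i) p) (⇒ (theorem φ (x ∷ ρ)) p))
      (λ L → let x = λ i → choose (λ x → Satisfies M φ (x ∷ at i ρ)) M.inhabitant in
        x , ⇐ (theorem φ (x ∷ ρ)) (upward (λ {i} ex → subst (Satisfies M φ) (sym (at-∷ x ρ i))
                                               (choose-spec _ M.inhabitant ex)) L))

  ultrapower-≡ₑ : ∀ {L} (M : Structure L) (𝒰 : Ultrafilter ℕ) → M ≡ₑ ultrapower M 𝒰
  ultrapower-≡ₑ M 𝒰 φ = mk⇔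
    (λ p → ⇐ (Ł.theorem φ []) (upward (λ {i} _ → subst (Satisfies M φ) (sym (at-[] i)) p) full))
    (λ p → byContradiction λ ¬p → proper
      (upward (λ {i} q → ¬p (subst (Satisfies M φ) (at-[] i) q)) (⇒ (Ł.theorem φ []) p)))
    where
    open Ultrafilter 𝒰
    module Ł = Łoś M 𝒰
    at-[] : ∀ i → Ł.at i [] ≡ []
    at-[] i = extensionality λ ()

  ≡ₑ⇔ultrapower-≡ₑ : ∀ {L} (M N : Structure L) (𝒰 : Ultrafilter ℕ) →
                     (M ≡ₑ N) ⇔ (ultrapower M 𝒰 ≡ₑ ultrapower N 𝒰)
  ≡ₑ⇔ultrapower-≡ₑ M N 𝒰 = mk⇔
    (λ e φ → ultrapower-≡ₑ N 𝒰 φ ⇔-∘ (e φ ⇔-∘ ⇔-sym (ultrapower-≡ₑ M 𝒰 φ)))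
    (λ e φ → ⇔-sym (ultrapower-≡ₑ N 𝒰 φ) ⇔-∘ (e φ ⇔-∘ ultrapower-≡ₑ M 𝒰 φ))

  -- Countable saturation

  countable-enumeration : {A : Set} {P : Pred A 0ℓ} (d : A) → P d → Countable P →
                          ∃ λ (e : ℕ → A) → (∀ n → P (e n)) × ∀ x → P x → ∃ λ n → e n ≡ x
  countable-enumeration {A} {P} d Pd (f , f-injective) = e , e∈P , hits
    where
    Q : ℕ → A → Set
    Q n x = P x × f x ≡ n
    e : ℕ → A
    e n = choose (Q n) d
    e∈P : ∀ n → P (e n)
    e∈P n with em (∃ (Q n))
    ... | yes (_ , Px , _) = Px
    ... | no _             = Pd
    hits : ∀ x → P x → ∃ λ n → e n ≡ x
    hits x Px = let Pe , eq = choose-spec (Q (f x)) d (x , Px , refl) in f x , f-injective Pe Px eq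

  module Realization (𝒰 : Ultrafilter ℕ) (cofinite : ∀ m → Ultrafilter.Large 𝒰 (m ≤_)) where
    open Ultrafilter 𝒰

    -- At index n, satisfy the longest realizable sequence of at most n conditions.
    realize : {X : Set} → X → (P : ℕ → ℕ → X → Set) →
              (∀ k → Large (λ n → ∃ λ x → ∀ l → l < k → P l n x)) →
              ∃ λ (y : ℕ → X) → ∀ l → Large (λ n → P l n (y n))
    realize {X} d P satisfiable = y , λ l →
      -- Condition l is the last one in the sequence of length `suc l`, which `Best n n` takes into
      -- account when n ≥ `suc l`; `cofinite` discards the other indices.
      upward (λ (l<n , sat) → choose-spec (Best _ _) d (best _ _) (suc l) l<n sat l ≤-refl)
             (intersection (cofinite (suc l)) (satisfiable (suc l)))
      where
      Best : ℕ → ℕ → X → Set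
      Best m n x = ∀ k → k ≤ m → (∃ λ x → ∀ l → l < k → P l n x) → ∀ l → l < k → P l n x
      best : ∀ m n → ∃ (Best m n)
      best zero    n = d , λ { zero _ _ l () }
      best (suc m) n with em (∃ λ x → ∀ l → l < suc m → P l n x)
      ... | yes (x , Px) = x , λ k k≤1+m _ l l<k → Px l (<-≤-trans l<k k≤1+m)
      ... | no  none     = let x , x-best = best m n in x , λ k k≤1+m sat →
        [ (λ k<1+m → x-best k (s≤s⁻¹ k<1+m) sat) , (λ { refl → contradiction sat none }) ]′ (m≤n⇒m<n∨m≡n k≤1+m)
      y : ℕ → X
      y n = choose (Best n n) d

    module _ {L : Language} (countable : CountableLanguage L) (M N : Structure L)
             {A : Set} (K : Pred A 0ℓ) (K-countable : Countable K)
             (a : A → ℕ → Structure.Carrier M) (b : A → ℕ → Structure.Carrier N) where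
      private
        module M = Structure M
        module N = Structure N
        module ŁN = Łoś N 𝒰
        M* = ultrapower M 𝒰
        N* = ultrapower N 𝒰

      Elementary : Set
      Elementary = ∀ {n} (w : Vector A n) → (∀ k → K (w k)) →
                   ∀ φ → Satisfies M* φ (a ∘ w) ⇔ Satisfies N* φ (b ∘ w)

      ElementaryAt : (ℕ → M.Carrier) → (ℕ → N.Carrier) → Set
      ElementaryAt x y = ∀ {n} (w : Vector A n) → (∀ k → K (w k)) →
                         ∀ φ → Satisfies M* φ (x ∷ a ∘ w) ⇔ Satisfies N* φ (y ∷ b ∘ w)

      -- The type of x over countably many parameters is itself countable. A finite part of it is
      -- one formula, whose existential closure transfers to `N*` by elementarity, and `realize`
      -- handles all parts together. Preservation of `¬′ φ` gives the converse for φ.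
      extend : Elementary → ∀ x → ∃ (ElementaryAt x)
      extend elementary x = y , λ {n} w Kw φ → mk⇔ (preserve w Kw φ) λ q → byContradiction λ ¬p →
        preserve w Kw (¬′ φ) ¬p q
        where
        Condition : Set
        Condition = ∃ λ n → Formula L (suc n) × Vector A n

        True : Pred Condition 0ℓ
        True (n , φ , w) = (∀ k → K (w k)) × Satisfies M* φ (x ∷ a ∘ w)

        open Coding countable extensionality

        true-countable : Countable True
        true-countable = code , injective
          where
          code : Condition → ℕ
          code (n , φ , w) = pair n (pair (codeFormula φ) (codeVector (proj₁ K-countable ∘ w)))
          injective : ∀ {θ θ′} → True θ → True θ′ → code θ ≡ code θ′ → θ ≡ θ′
          injective {n , φ , w} {n′ , φ′ , w′} (Kw , _) (Kw′ , _) eq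
            with refl , eq′ ← pair-injective eq
            with φ-eq , w-eq ← pair-injective eq′ =
              cong₂ (λ φ w → n , φ , w) (codeFormula-injective φ φ′ φ-eq)
                (extensionality λ k → proj₂ K-countable (Kw k) (Kw′ k) (codeVector-injective _ _ w-eq k))

        trivial : Condition
        trivial = 0 , var zero ≐ var zero , []

        Holds : Condition → ℕ → N.Carrier → Set
        Holds (n , φ , w) i z = Satisfies N φ (z ∷ ŁN.at i (b ∘ w))

        weaken : ∀ {S : Structure L} {m n} (s : Fin m → Fin n) (φ : Formula L (suc m)) z
                 (ρ : Vector (Structure.Carrier S) n) {σ : Vector (Structure.Carrier S) m} → (∀ k → ρ (s k) ≡ σ k) →
                 Satisfies S (rename (lift s) φ) (z ∷ ρ) ≡ Satisfies S φ (z ∷ σ)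
        weaken {S} s φ z ρ eq = trans (rename-Satisfies extensionality S (lift s) φ (z ∷ ρ))
          (cong (Satisfies S φ) (extensionality λ { zero → refl ; (suc k) → eq k }))

        -- The two conditions have different parameter tuples; after concatenation each formula is
        -- renamed into its own block, with variable 0, the element sought, kept fixed.
        conjunction : ∀ θ θ′ → True θ → True θ′ →
                      ∃ λ θ″ → True θ″ × ∀ i z → Holds θ″ i z → Holds θ i z × Holds θ′ i z
        conjunction (n , φ , w) (n′ , φ′ , w′) (Kw , p) (Kw′ , p′) =
          (n + n′ , rename (lift (_↑ˡ n′)) φ ∧′ rename (lift (n ↑ʳ_)) φ′ , w ++ w′) ,
          (++-all {P = K} w w′ Kw Kw′ ,
           subst (λ P → P) (sym (weaken {M*} _ φ x _ λ k → cong a (left k))) p ,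
           subst (λ P → P) (sym (weaken {M*} _ φ′ x _ λ k → cong a (right k))) p′) ,
          λ i z (q , q′) →
           subst (λ P → P) (weaken {N} _ φ z _ λ k → cong (λ u → b u i) (left k)) q ,
           subst (λ P → P) (weaken {N} _ φ′ z _ λ k → cong (λ u → b u i) (right k)) q′
          where
          left : ∀ k → (w ++ w′) (k ↑ˡ n′) ≡ w k
          left = lookup-++ˡ w w′
          right : ∀ k → (w ++ w′) (n ↑ʳ k) ≡ w′ k
          right = lookup-++ʳ w w′

        enumeration = countable-enumeration trivial ((λ ()) , Structure.refl M*) true-countable

        θ : ℕ → Condition
        θ = proj₁ enumeration

        conjunctions : ∀ m → ∃ λ θ″ → True θ″ × ∀ i z → Holds θ″ i z → ∀ l → l < m → Holds (θ l) i z
        conjunctions zero    = trivial , ((λ ()) , Structure.refl M*) , λ _ _ _ _ ()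
        conjunctions (suc m) =
          let θ′ , true′ , holds′ = conjunctions m
              θ″ , true″ , holds″ = conjunction θ′ (θ m) true′ (proj₁ (proj₂ enumeration) m)
          in θ″ , true″ , λ i z h l l<1+m → [ (λ l<m → holds′ i z (proj₁ (holds″ i z h)) l (s≤s⁻¹ l<m))
                                             , (λ { refl → proj₂ (holds″ i z h) }) ]′ (m≤n⇒m<n∨m≡n l<1+m)

        realized : ∃ λ (y : ℕ → N.Carrier) → ∀ l → Large (λ i → Holds (θ l) i (y i))
        realized = realize N.inhabitant (λ l → Holds (θ l)) λ m →
          let (n , φ , w) , (Kw , p) , holds = conjunctions m in
          upward (λ {i} (z , h) → z , holds i z h)
            (⇒ (ŁN.theorem (∃′ φ) (b ∘ w)) (⇒ (elementary w Kw (∃′ φ)) (x , p)))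

        y : ℕ → N.Carrier
        y = proj₁ realized

        preserve : ∀ {n} (w : Vector A n) → (∀ k → K (w k)) →
                   ∀ φ → Satisfies M* φ (x ∷ a ∘ w) → Satisfies N* φ (y ∷ b ∘ w)
        preserve w Kw φ p with l , eq ← proj₂ (proj₂ enumeration) (_ , φ , w) (Kw , p) =
          ⇐ (ŁN.theorem φ _) (upward (λ {i} → subst (Satisfies N φ) (sym (ŁN.at-∷ y (b ∘ w) i)))
            (subst (λ θ → Large (λ i → Holds θ i (y i))) eq (proj₂ realized l)))

  -- This is (2^ℵ₀)^ℵ₀ = 2^ℵ₀: a sequence of bit sequences is one bit sequence via `pair`. Codes of
  -- no sequence receive the constant sequence at `default`.
  sequences-enumeration : (A : Setoid 0ℓ 0ℓ) → Setoid.Carrier A → Injection A Continuum →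
                          ∃ λ (d : (ℕ → Bool) → ℕ → Setoid.Carrier A) →
                          ∀ (x : ℕ → Setoid.Carrier A) → ∃ λ i → ∀ n → Setoid._≈_ A (d i n) (x n)
  sequences-enumeration A default embedding = (λ i → choose (Codes i) (λ _ → default)) , λ x →
    code x , λ n → injective λ k →
      trans (sym (choose-spec (Codes (code x)) _ (x , code-codes x) n k)) (code-codes x n k)
    where
    open Injection embedding
    Codes : (ℕ → Bool) → (ℕ → Setoid.Carrier A) → Set
    Codes i x = ∀ n k → i (pair n k) ≡ to (x n) k
    code : (ℕ → Setoid.Carrier A) → ℕ → Bool
    code x p = decide (∃ λ n → ∃ λ k → pair n k ≡ p × to (x n) k ≡ true)
    code-codes : ∀ x → Codes (code x) x
    code-codes x n k with to (x n) k in eq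
    ... | true  = decide-complete (n , k , refl , eq)
    ... | false = ¬-not λ coded → coded-false (decide-sound coded)
      where
      coded-false : (∃ λ n′ → ∃ λ k′ → pair n′ k′ ≡ pair n k × to (x n′) k′ ≡ true) → ⊥
      coded-false (n′ , k′ , p , eq′) with refl , refl ← pair-injective p
        with () ← trans (sym eq) eq′

  module _ {L : Language} {M N : Structure L} {I : Set}
           (a : I → Structure.Carrier M) (b : I → Structure.Carrier N)
           (elementary : ∀ {n} (w : Vector I n) φ → Satisfies M φ (a ∘ w) ⇔ Satisfies N φ (b ∘ w))
           (a-onto : ∀ x → ∃ λ i → Structure._≈_ M (a i) x)
           (b-onto : ∀ y → ∃ λ i → Structure._≈_ N (b i) y) where
    private
      module M = Structure M
      module N = Structure N

      index : M.Carrier → I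
      index x = proj₁ (a-onto x)

      a-index : ∀ x → a (index x) M.≈ x
      a-index x = proj₂ (a-onto x)

      same-equalities : ∀ i j → (a i M.≈ a j) ⇔ (b i N.≈ b j)
      same-equalities i j = elementary (i ∷ j ∷ []) (var zero ≐ var (suc zero))

    -- The formula v₀ = v₁ makes the assignment of `b i` to `a i` well defined and injective. A
    -- value of a function also has an index, so homomorphy is the transfer of v₀ = f(v₁, ...).
    elementary⇒≃ : M ≃ N
    elementary⇒≃ = record
      { bijection = record
        { to        = b ∘ index
        ; cong      = λ {x} {y} x≈y → ⇒ (same-equalities _ _)
                        (M.trans (a-index x) (M.trans x≈y (M.sym (a-index y))))
        ; bijective =
            (λ {x} {y} eq → M.trans (M.sym (a-index x)) (M.trans (⇐ (same-equalities _ _) eq) (a-index y))) ,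
            λ y → let i , bi≈y = b-onto y in
              a i , λ {z} z≈ai → N.trans (⇒ (same-equalities _ _) (M.trans (a-index z) z≈ai)) bi≈y
        }
      ; fun-homo = λ f xs → ⇒ (elementary (index (M.fun f xs) ∷ index ∘ xs) (var zero ≐ app f (var ∘ suc)))
          (M.trans (a-index _) (M.fun-cong f λ j → M.sym (a-index (xs j))))
      ; rel-iso  = λ R xs → elementary (index ∘ xs) (atom R var) ⇔-∘
          mk⇔ (M.rel-resp R λ j → M.sym (a-index (xs j))) (M.rel-resp R λ j → a-index (xs j))
      }

  -- Back and forth along a well-ordering of the continuum with countable initial segments: at stage
  -- i the first bit of i says in which of the two ultrapowers the element coded by the remaining
  -- bits is added.

  module _ (r : (ℕ → Bool) → Ord) (r-injective : ∀ {x y} → r x ≋ r y → x ≡ y)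
           (segment-countable : ∀ x → Countable (λ y → r y ≺ r x))
           (𝒰 : Ultrafilter ℕ) (cofinite : ∀ m → Ultrafilter.Large 𝒰 (m ≤_))
           {L : Language} (countable : CountableLanguage L) (M N : Structure L)
           (M-size : SizeAtMostContinuum M) (N-size : SizeAtMostContinuum N)
           (M*≡N* : ultrapower M 𝒰 ≡ₑ ultrapower N 𝒰) where
    open WellOrdered r r-injective
    open Realization 𝒰 cofinite
    open Ultrafilter 𝒰 using (upward; full)
    private
      module M = Structure M
      module N = Structure N
      M* = ultrapower M 𝒰
      N* = ultrapower N 𝒰
      enumM = sequences-enumeration M.universe M.inhabitant M-size
      enumN = sequences-enumeration N.universe N.inhabitant N-size

      Stage : Set
      Stage = (ℕ → M.Carrier) × (ℕ → N.Carrier)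

      Adds : Bool → (ℕ → Bool) → Pred Stage 0ℓ
      Adds true  j (x , y) = x ≡ proj₁ enumM j
      Adds false j (x , y) = y ≡ proj₁ enumN j

      GoodFor : (i : ℕ → Bool) → ((ℕ → Bool) → Stage) → Bool → (ℕ → Bool) → Pred Stage 0ℓ
      GoodFor i g β j (x , y) = Adds β j (x , y) ×
        ElementaryAt countable M N (_◂ i) (segment-countable i) (proj₁ ∘ g) (proj₂ ∘ g) x y

      Good : (i : ℕ → Bool) → ((ℕ → Bool) → Stage) → Pred Stage 0ℓ
      Good i g = GoodFor i g (i zero) (i ∘ suc)

      default : Stage
      default = (λ _ → M.inhabitant) , (λ _ → N.inhabitant)

      module R = Recursion ◂-wellFounded default (λ i g → choose (Good i g) default)

      stage : (ℕ → Bool) → Stage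
      stage = R.solution

      a : (ℕ → Bool) → ℕ → M.Carrier
      a = proj₁ ∘ stage

      b : (ℕ → Bool) → ℕ → N.Carrier
      b = proj₂ ∘ stage

      Elem : ∀ {n} → Vector (ℕ → Bool) n → Set
      Elem w = ∀ φ → Satisfies M* φ (a ∘ w) ⇔ Satisfies N* φ (b ∘ w)

      module _ (i : ℕ → Bool) (below : ∀ {n} (w : Vector (ℕ → Bool) n) → (∀ k → w k ◂ i) → Elem w) where
        g : (ℕ → Bool) → Stage
        g = R.restrict {i} (λ {j} _ → stage j)

        g-eq : ∀ {n} (w : Vector (ℕ → Bool) n) → (∀ k → w k ◂ i) → g ∘ w ≡ stage ∘ w
        g-eq w w◂i = extensionality λ k → R.restrict-< stage (w◂i k)

        g-elementary : Elementary countable M N (_◂ i) (segment-countable i) (proj₁ ∘ g) (proj₂ ∘ g)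
        g-elementary w w◂i φ = subst (λ c → Satisfies M* φ (proj₁ ∘ c) ⇔ Satisfies N* φ (proj₂ ∘ c))
          (sym (g-eq w w◂i)) (below w w◂i φ)

        g-extends : ∀ β j → ∃ (GoodFor i g β j)
        g-extends true j =
          let y , e = extend countable M N _ (segment-countable i) (proj₁ ∘ g) (proj₂ ∘ g)
                        g-elementary (proj₁ enumM j)
          in (_ , y) , refl , e
        g-extends false j =
          let x , e = extend countable N M _ (segment-countable i) (proj₂ ∘ g) (proj₁ ∘ g)
                        (λ w w◂i φ → ⇔-sym (g-elementary w w◂i φ)) (proj₁ enumN j)
          in (x , _) , refl , λ w w◂i φ → ⇔-sym (e w w◂i φ)

        stage-good : Good i g (stage i)
        stage-good = subst (Good i g) (sym (R.solution-eq i))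
          (choose-spec (Good i g) default (g-extends (i zero) (i ∘ suc)))

        stage-adds : Adds (i zero) (i ∘ suc) (stage i)
        stage-adds = proj₁ stage-good

        stage-elementary : ∀ {n} (w : Vector (ℕ → Bool) n) → (∀ k → w k ◂ i) → Elem (i ∷ w)
        stage-elementary w w◂i φ = subst₂ (λ ρ σ → Satisfies M* φ ρ ⇔ Satisfies N* φ σ)
          (extensionality λ { zero → refl ; (suc k) → cong (λ c → proj₁ (c k)) (g-eq w w◂i) })
          (extensionality λ { zero → refl ; (suc k) → cong (λ c → proj₂ (c k)) (g-eq w w◂i) })
          (proj₂ stage-good w w◂i φ)

      -- The empty tuple is the case of sentences, that is `M*≡N*`; reindexing a tuple amounts to
      -- renaming variables in the formula.
      elementary : ∀ {n} (w : Vector (ℕ → Bool) n) → Elem w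
      elementary = FiniteCharacter.all-tuples Elem
        (λ φ → subst₂ (λ ρ σ → Satisfies M* φ ρ ⇔ Satisfies N* φ σ)
                 (extensionality λ ()) (extensionality λ ()) (M*≡N* φ))
        (λ w s e φ → subst₂ _⇔_ (rename-Satisfies extensionality M* s φ (a ∘ w))
                       (rename-Satisfies extensionality N* s φ (b ∘ w)) (e (rename s φ)))
        stage-elementary

      adds : ∀ i → Adds (i zero) (i ∘ suc) (stage i)
      adds i = stage-adds i λ w _ → elementary w

      bit : Bool → (ℕ → Bool) → ℕ → Bool
      bit β j zero    = β
      bit β j (suc n) = j n

      a-onto : ∀ x → ∃ λ i → Structure._≈_ M* (a i) x
      a-onto x with j , eq ← proj₂ enumM x =
        bit true j , upward (λ {n} _ → M.trans (M.reflexive (cong (λ f → f n) (adds (bit true j)))) (eq n)) full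

      b-onto : ∀ y → ∃ λ i → Structure._≈_ N* (b i) y
      b-onto y with j , eq ← proj₂ enumN y =
        bit false j , upward (λ {n} _ → N.trans (N.reflexive (cong (λ f → f n) (adds (bit false j)))) (eq n)) full

    backAndForth : M* ≃ N*
    backAndForth = elementary⇒≃ a b elementary a-onto b-onto

  ω₁-ordered⇒Keisler : ω₁-Ordered (ℕ → Bool) → KeislerCriterion
  ω₁-ordered⇒Keisler (r , r-injective , segment-countable) L countable M N M-size N-size = mk⇔
    (λ M≡N → isomorphism M≡N (nonprincipal r r-injective))
    (λ (𝒰 , M*≃N*) → ⇐ (≡ₑ⇔ultrapower-≡ₑ M N 𝒰) (≃⇒≡ₑ {M = ultrapower M 𝒰} {ultrapower N 𝒰} M*≃N*))
    where
    isomorphism : M ≡ₑ N → (∃ λ (𝒰 : Ultrafilter ℕ) → ∀ m → Ultrafilter.Large 𝒰 (m ≤_)) →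
                  ∃ λ (𝒰 : Ultrafilter ℕ) → ultrapower M 𝒰 ≃ ultrapower N 𝒰
    isomorphism M≡N (𝒰 , cofinite) =
      𝒰 , backAndForth r r-injective segment-countable 𝒰 cofinite countable M N M-size N-size
            (⇒ (≡ₑ⇔ultrapower-≡ₑ M N 𝒰) M≡N)

  -- Elementary equivalence of dense linear orders without endpoints

  module DenseOrders (D E : DenseOrder) where
    private
      module D = DenseOrder D
      module E = DenseOrder E

    -- Implications from D to E suffice: by trichotomy in D and irreflexivity in E they can be
    -- reversed (`same-sym`).
    Same : ∀ {n} → Vector D.Carrier n → Vector E.Carrier n → Set
    Same ρ σ = ∀ i j → (ρ i D.⊏ ρ j → σ i E.⊏ σ j) × (ρ i ≡ ρ j → σ i ≡ σ j)

    _≤ᴱ_ : Rel E.Carrier 0ℓ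
    x ≤ᴱ y = x ≡ y ⊎ x E.⊏ y

    ≤ᴱ-trans : ∀ {x y z} → x ≤ᴱ y → y ≤ᴱ z → x ≤ᴱ z
    ≤ᴱ-trans (inj₁ refl) q           = q
    ≤ᴱ-trans (inj₂ p)    (inj₁ refl) = inj₂ p
    ≤ᴱ-trans (inj₂ p)    (inj₂ q)    = inj₂ (E.⊏-trans p q)

    ≤ᴱ-total : ∀ x y → x ≤ᴱ y ⊎ y ≤ᴱ x
    ≤ᴱ-total x y with E.⊏-total x y
    ... | inj₁ p        = inj₁ (inj₂ p)
    ... | inj₂ (inj₁ p) = inj₁ (inj₁ p)
    ... | inj₂ (inj₂ p) = inj₂ (inj₂ p)

    ≤-⊏-trans : ∀ {x y z} → x ≤ᴱ y → y E.⊏ z → x E.⊏ z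
    ≤-⊏-trans (inj₁ refl) q = q
    ≤-⊏-trans (inj₂ p)    q = E.⊏-trans p q

    ⊏-≤-trans : ∀ {x y z} → x E.⊏ y → y ≤ᴱ z → x E.⊏ z
    ⊏-≤-trans p (inj₁ refl) = p
    ⊏-≤-trans p (inj₂ q)    = E.⊏-trans p q

    interpolate : ∀ {n} (σ : Vector E.Carrier n) (P Q : Pred (Fin n) 0ℓ) →
                  (∀ {i j} → P i → Q j → σ i E.⊏ σ j) →
                  ∃ λ y → (∀ i → P i → σ i E.⊏ y) × (∀ j → Q j → y E.⊏ σ j)
    interpolate σ P Q P<Q
      with maximum _≤ᴱ_ (λ _ → inj₁ refl) ≤ᴱ-trans ≤ᴱ-total σ P
         | maximum (λ x y → y ≤ᴱ x) (λ _ → inj₁ refl) (λ p q → ≤ᴱ-trans q p) (λ x y → ≤ᴱ-total y x) σ Q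
    ... | inj₁ ¬P | inj₁ ¬Q = E.point , (λ i Pi → contradiction Pi (¬P i)) , λ j Qj → contradiction Qj (¬Q j)
    ... | inj₁ ¬P | inj₂ (j , _ , j-min) = let y , y<j = E.below (σ j) in
      y , (λ i Pi → contradiction Pi (¬P i)) , λ j′ Qj′ → ⊏-≤-trans y<j (j-min j′ Qj′)
    ... | inj₂ (i , _ , i-max) | inj₁ ¬Q = let y , i<y = E.above (σ i) in
      y , (λ i′ Pi′ → ≤-⊏-trans (i-max i′ Pi′) i<y) , λ j Qj → contradiction Qj (¬Q j)
    ... | inj₂ (i , Pi , i-max) | inj₂ (j , Qj , j-min) = let y , i<y , y<j = E.dense (P<Q Pi Qj) in
      y , (λ i′ Pi′ → ≤-⊏-trans (i-max i′ Pi′) i<y) , λ j′ Qj′ → ⊏-≤-trans y<j (j-min j′ Qj′)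

    forth : ∀ {n} {ρ : Vector D.Carrier n} {σ} → Same ρ σ → ∀ x → ∃ λ y → Same (x ∷ ρ) (y ∷ σ)
    forth {n} {ρ} {σ} same x with em (∃ λ i → ρ i ≡ x)
    ... | yes (i , refl) = σ i , λ
      { zero    zero    → (λ p → contradiction p D.⊏-irrefl) , λ _ → refl
      ; zero    (suc k) → same i k
      ; (suc j) zero    → same j i
      ; (suc j) (suc k) → same j k
      }
    ... | no new =
      let y , less , greater = interpolate σ (λ i → ρ i D.⊏ x) (λ j → x D.⊏ ρ j)
                                 (λ p q → proj₁ (same _ _) (D.⊏-trans p q))
      in y , λ
      { zero    zero    → (λ p → contradiction p D.⊏-irrefl) , λ _ → refl
      ; zero    (suc k) → greater k , λ eq → contradiction (k , sym eq) new
      ; (suc j) zero    → less j , λ eq → contradiction (j , eq) new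
      ; (suc j) (suc k) → same j k
      }

    ⊏⇒≢ : ∀ {x y} → x E.⊏ y → x ≢ y
    ⊏⇒≢ p refl = E.⊏-irrefl p

    same-sym : ∀ {n} {ρ : Vector D.Carrier n} {σ} → Same ρ σ →
               ∀ i j → (σ i E.⊏ σ j → ρ i D.⊏ ρ j) × (σ i ≡ σ j → ρ i ≡ ρ j)
    same-sym {ρ = ρ} same i j with D.⊏-total (ρ i) (ρ j)
    ... | inj₁ p        = (λ _ → p) , λ eq → contradiction eq (⊏⇒≢ (proj₁ (same i j) p))
    ... | inj₂ (inj₁ p) = (λ q → contradiction (proj₂ (same i j) p) (⊏⇒≢ q)) , λ _ → p
    ... | inj₂ (inj₂ p) = (λ q → contradiction (E.⊏-trans q (proj₁ (same j i) p)) E.⊏-irrefl) ,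
      λ eq → contradiction (sym eq) (⊏⇒≢ (proj₁ (same j i) p))

  denseOrders-≡ₑ : ∀ D E → orderStructure D ≡ₑ orderStructure E
  denseOrders-≡ₑ D E = BackAndForth.preserves (orderStructure D) (orderStructure E) D,E.Same
    equality
    (λ { {σ = σ} same tt ts → relation same (ts zero) (ts (suc zero)) })
    D,E.forth
    (λ {n} {ρ} {σ} same y → let x , same′ = E,D.forth (D,E.same-sym same) y in x , E,D.same-sym same′)
    λ ()
    where
    module D,E = DenseOrders D E
    module E,D = DenseOrders E D
    M = orderStructure D
    N = orderStructure E
    equality : ∀ {n} {ρ : Vector _ n} {σ} → D,E.Same ρ σ → ∀ s t →
               (⟦ M ⟧ s ρ ≡ ⟦ M ⟧ t ρ) ⇔ (⟦ N ⟧ s σ ≡ ⟦ N ⟧ t σ)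
    equality same (var i) (var j) = mk⇔ (proj₂ (same i j)) (proj₂ (D,E.same-sym same i j))
    relation : ∀ {n} {ρ : Vector _ n} {σ} → D,E.Same ρ σ → ∀ s t →
               (DenseOrder._⊏_ D (⟦ M ⟧ s ρ) (⟦ M ⟧ t ρ)) ⇔ (DenseOrder._⊏_ E (⟦ N ⟧ s σ) (⟦ N ⟧ t σ))
    relation same (var i) (var j) = mk⇔ (proj₁ (same i j)) (proj₁ (D,E.same-sym same i j))

  -- The lexicographic product with ℚ

  module _ {J : Set} (j₀ : J) (r : J → Ord) (r-injective : ∀ {i j} → r i ≋ r j → i ≡ j) where
    open WellOrdered r r-injective

    private
      Lex : Rel (J × ℚ) 0ℓ
      Lex (i , p) (j , q) = i ◂ j ⊎ i ≡ j × p ℚ.< q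

      lex-total : ∀ x y → Lex x y ⊎ x ≡ y ⊎ Lex y x
      lex-total (i , p) (j , q) with ◂-total i j
      ... | inj₁ i◂j        = inj₁ (inj₁ i◂j)
      ... | inj₂ (inj₂ j◂i) = inj₂ (inj₂ (inj₁ j◂i))
      ... | inj₂ (inj₁ refl) with ℚ.<-cmp p q
      ... | tri< p<q _ _ = inj₁ (inj₂ (refl , p<q))
      ... | tri≈ _ p≡q _ = inj₂ (inj₁ (cong (i ,_) p≡q))
      ... | tri> _ _ q<p = inj₂ (inj₂ (inj₂ (refl , q<p)))

      lex-trans : ∀ {x y z} → Lex x y → Lex y z → Lex x z
      lex-trans {i , _} {j , _} {k , _} (inj₁ p) (inj₁ q) = inj₁ (◂-trans {i} {j} {k} p q)
      lex-trans (inj₁ p) (inj₂ (refl , _))          = inj₁ p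
      lex-trans (inj₂ (refl , _)) (inj₁ q)          = inj₁ q
      lex-trans (inj₂ (refl , p)) (inj₂ (refl , q)) = inj₂ (refl , ℚ.<-trans p q)

      p<p+1 : ∀ p → p ℚ.< p ℚ.+ 1ℚ
      p<p+1 p = subst (ℚ._< p ℚ.+ 1ℚ) (ℚ.+-identityʳ p) (ℚ.+-monoʳ-< p (ℚ.positive⁻¹ 1ℚ))

      p-1<p : ∀ p → p ℚ.+ - 1ℚ ℚ.< p
      p-1<p p = subst (p ℚ.+ - 1ℚ ℚ.<_) (ℚ.+-identityʳ p) (ℚ.+-monoʳ-< p (ℚ.negative⁻¹ (- 1ℚ)))

    _×ℚ : DenseOrder
    _×ℚ = record
      { Carrier  = J × ℚ
      ; _⊏_      = Lex
      ; point    = j₀ , 0ℚ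
      ; ⊏-irrefl = λ { {i , _} (inj₁ i◂i) → ◂-irrefl {i} i◂i ; (inj₂ (_ , p<p)) → ℚ.<-irrefl refl p<p }
      ; ⊏-trans  = lex-trans
      ; ⊏-total  = lex-total
      ; dense    = λ
        -- Nothing need lie between i and j: the copy of ℚ at i has no last element.
        { {i , p} (inj₁ i◂j) → (i , p ℚ.+ 1ℚ) , inj₂ (refl , p<p+1 p) , inj₁ i◂j
        ; {i , p} (inj₂ (refl , p<q)) → let m , p<m , m<q = ℚ.<-dense p<q in
            (i , m) , inj₂ (refl , p<m) , inj₂ (refl , m<q)
        }
      ; above    = λ (i , p) → (i , p ℚ.+ 1ℚ) , inj₂ (refl , p<p+1 p)
      ; below    = λ (i , p) → (i , p ℚ.+ - 1ℚ) , inj₂ (refl , p-1<p p)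
      }

    ×ℚ-size : (e : J → ℕ → Bool) → (∀ {i j} → (∀ k → e i k ≡ e j k) → i ≡ j) →
              SizeAtMostContinuum (orderStructure _×ℚ)
    ×ℚ-size e e-injective = record
      { to        = λ (i , p) → prefix (codeℚ p) (e i)
      ; cong      = λ { refl k → refl }
      ; injective = λ {(i , p)} {(j , q)} eq →
          let p-eq , i-eq = prefix-injective (codeℚ p) (codeℚ q) eq in
          cong₂ _,_ (e-injective i-eq) (codeℚ-injective p q p-eq)
      }

  -- Ideals of countable sets and of sets of size at most ℵ₁

  countable-insert : {A : Set} {P : Pred A 0ℓ} (x : A) → Countable P → Countable (λ y → y ≡ x ⊎ P y)
  countable-insert {A} {P} x (f , f-injective) = g , injective
    where
    g : A → ℕ
    g y with em (y ≡ x)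
    ... | yes _ = 0
    ... | no _  = suc (f y)
    injective : ∀ {y z} → y ≡ x ⊎ P y → z ≡ x ⊎ P z → g y ≡ g z → y ≡ z
    injective {y} {z} Py Pz eq with em (y ≡ x) | em (z ≡ x)
    ... | yes refl | yes refl = refl
    ... | no y≢x   | no z≢x   = f-injective
      ([ (λ y≡x → contradiction y≡x y≢x) , (λ p → p) ]′ Py)
      ([ (λ z≡x → contradiction z≡x z≢x) , (λ p → p) ]′ Pz) (suc-injective eq)

  countable-union : {I A : Set} {K : Pred I 0ℓ} {P : I → Pred A 0ℓ} → Countable K →
                    (∀ {i} → K i → Countable (P i)) → Countable (λ x → ∃ λ i → K i × P i x)
  countable-union {I} {A} {K} {P} (g , g-injective) P-countable =
    (λ x → choose (Code x) 0) , λ {x} {y} x∈ y∈ eq →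
      let i , Ki , Pix , x-code = code x∈
          j , Kj , Pjy , y-code = code y∈
      in same Ki Kj Pix Pjy (trans x-code (trans eq (sym y-code)))
    where
    number : I → A → ℕ
    number i = choose (λ f → ∀ {x y} → P i x → P i y → f x ≡ f y → x ≡ y) (λ _ → 0)
    number-injective : ∀ {i} → K i → ∀ {x y} → P i x → P i y → number i x ≡ number i y → x ≡ y
    number-injective {i} Ki = choose-spec (λ f → ∀ {x y} → P i x → P i y → f x ≡ f y → x ≡ y) _ (P-countable Ki)
    Code : A → ℕ → Set
    Code x n = ∃ λ i → K i × P i x × pair (g i) (number i x) ≡ n
    code : ∀ {x} → (∃ λ i → K i × P i x) → Code x (choose (Code x) 0)
    code (i , Ki , Pix) = choose-spec (Code _) 0 (_ , i , Ki , Pix , refl)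
    same : ∀ {i j x y} → K i → K j → P i x → P j y → pair (g i) (number i x) ≡ pair (g j) (number j y) → x ≡ y
    same Ki Kj Pix Pjy eq with g-eq , number-eq ← pair-injective eq
      with refl ← g-injective Ki Kj g-eq = number-injective Ki Pix Pjy number-eq

  module _ {A : Set} (r : A → Ord) (r-injective : ∀ {x y} → r x ≋ r y → x ≡ y) where
    open WellOrdered r r-injective

    module Segments (Ideal : Pred (Pred A 0ℓ) 0ℓ)
                    (⊆-closed : ∀ {P Q : Pred A 0ℓ} → P ⊆ Q → Ideal Q → Ideal P)
                    (insert : ∀ {P : Pred A 0ℓ} x → Ideal P → Ideal (λ y → y ≡ x ⊎ P y))
                    (proper : ¬ Ideal (λ _ → ⊤)) where

      Core : Pred A 0ℓ
      Core x = Ideal (_◂ x)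

      -- All predecessors of the least x outside `Core` belong to `Core`. Were `Core` in the ideal,
      -- so would be the segment below x, and x would belong to `Core` after all.
      Core∉Ideal : ¬ Ideal Core
      Core∉Ideal I with em (∀ x → Core x)
      ... | yes all = proper (⊆-closed (λ {x} _ → all x) I)
      ... | no ¬all =
        let x , x∉ , minimal = least (λ x → ¬ Core x) (¬∀⇒∃¬ ¬all)
        in x∉ (⊆-closed (λ {y} y◂x → byContradiction (minimal y y◂x)) I)

      -- An unbounded family in `Core` would cover `Core` by the closed initial segments up to its
      -- members. These lie in the ideal, and so would their union.
      bounded : {J : Set} → (∀ {P : J → Pred A 0ℓ} → (∀ j → Ideal (P j)) → Ideal (λ x → ∃ λ j → P j x)) →
                (S : J → A) → (∀ j → Core (S j)) → ∃ λ x → Core x × ∀ j → S j ◂ x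
      bounded union-closed S S∈Core = byContradiction λ unbounded →
        Core∉Ideal (⊆-closed (cover unbounded) (union-closed λ j → insert (S j) (S∈Core j)))
        where
        cover : ¬ (∃ λ x → Core x × ∀ j → S j ◂ x) → ∀ {x} → Core x → ∃ λ j → x ≡ S j ⊎ x ◂ S j
        cover unbounded {x} x∈ =
          let j , Sj⋪x = ¬∀⇒∃¬ λ all → unbounded (x , x∈ , all)
          in j , ≼⇒≡⊎◂ (⊀⇒≽ (r (S j)) (r x) Sj⋪x)

      Element : Set
      Element = ∃ λ x → decide (Core x) ≡ true

      rᴱ : Element → Ord
      rᴱ = r ∘ proj₁

      element-≡ : ∀ {u v : Element} → proj₁ u ≡ proj₁ v → u ≡ v
      element-≡ {x , p} {.x , q} refl = cong (x ,_) (uip p q)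

      rᴱ-injective : ∀ {u v} → rᴱ u ≋ rᴱ v → u ≡ v
      rᴱ-injective = element-≡ ∘ r-injective

      element : Ideal (λ _ → ⊥) → Element
      element ∅∈ with em (∃ Core)
      ... | yes (x , x∈) = x , decide-complete x∈
      ... | no none      = contradiction (⊆-closed (λ {x} x∈ → none (x , x∈)) ∅∈) Core∉Ideal

  countable-empty : {A : Set} → Countable {A} (λ _ → ⊥)
  countable-empty = (λ _ → 0) , λ ()

  countable-union-ℕ : {A : Set} {P : ℕ → Pred A 0ℓ} → (∀ n → Countable (P n)) → Countable (λ x → ∃ λ n → P n x)
  countable-union-ℕ P-countable = countable-⊆ (λ (n , Pnx) → n , tt , Pnx)
    (countable-union {K = λ _ → ⊤} ((λ n → n) , λ _ _ eq → eq) λ {n} _ → P-countable n)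

  -- Failure of the criterion when the continuum exceeds ℵ₁

  module _ (r : (ℕ → Bool) → Ord) (r-injective : ∀ {x y} → r x ≋ r y → x ≡ y)
           (¬CH : ¬ ContinuumHypothesis) where
    open WellOrdered r r-injective

    private
      module C₁ = Segments r r-injective Countable (λ {P} {Q} → countable-⊆ {P = P} {Q})
                    countable-insert continuum-uncountable

      J₁ : Set
      J₁ = C₁.Element

      r₁ : J₁ → Ord
      r₁ = C₁.rᴱ

      j₁ : J₁
      j₁ = C₁.element countable-empty

      -- The order type of J₁ is ω₁; a set is small if it maps to J₁ with countable preimages of
      -- the initial segments.
      Small : Pred (Pred (ℕ → Bool) 0ℓ) 0ℓ
      Small P = ∃ λ (m : (ℕ → Bool) → J₁) → ∀ ξ → Countable (λ x → P x × r₁ (m x) ≼ r₁ ξ)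

      initial-countable : ∀ (ξ : J₁) → Countable (λ ζ → r₁ ζ ≼ r₁ ξ)
      initial-countable ξ@(x , x∈) =
        let f , f-injective = countable-insert x (decide-sound x∈)
        in f ∘ proj₁ , λ ζ≼ξ ζ′≼ξ eq → C₁.element-≡ (f-injective (≼⇒≡⊎◂ ζ≼ξ) (≼⇒≡⊎◂ ζ′≼ξ) eq)

      upperBound : ∀ ξ ζ → ∃ λ μ → r₁ ξ ≼ r₁ μ × r₁ ζ ≼ r₁ μ
      upperBound ξ ζ with ≼-total (r₁ ξ) (r₁ ζ)
      ... | inj₁ ξ≼ζ = ζ , ξ≼ζ , ≼-refl _
      ... | inj₂ ζ≺ξ = ξ , ≼-refl _ , ≺⇒≼ _ _ ζ≺ξ

      small-⊆ : ∀ {P Q : Pred (ℕ → Bool) 0ℓ} → P ⊆ Q → Small Q → Small P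
      small-⊆ P⊆Q (m , m-countable) = m , λ ξ → countable-⊆ (λ (Px , m≼) → P⊆Q Px , m≼) (m-countable ξ)

      small-insert : ∀ {P : Pred (ℕ → Bool) 0ℓ} x → Small P → Small (λ y → y ≡ x ⊎ P y)
      small-insert x (m , m-countable) = m , λ ξ → countable-⊆
        (λ { (inj₁ y≡x , _) → inj₁ y≡x ; (inj₂ Py , m≼) → inj₂ (Py , m≼) })
        (countable-insert x (m-countable ξ))

      small-empty : Small (λ _ → ⊥)
      small-empty = (λ _ → j₁) , λ ξ → countable-⊆ proj₁ countable-empty

      small-union-ℕ : ∀ {P : ℕ → Pred (ℕ → Bool) 0ℓ} → (∀ n → Small (P n)) → Small (λ x → ∃ λ n → P n x)
      small-union-ℕ {P} P-small = (λ x → proj₁ (P-small (index x)) x) , λ ξ → countable-⊆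
        (λ {x} (x∈ , m≼ξ) → index x , choose-spec (λ n → P n x) 0 x∈ , m≼ξ)
        (countable-union-ℕ λ n → proj₂ (P-small n) ξ)
        where
        index : (ℕ → Bool) → ℕ
        index x = choose (λ n → P n x) 0

      -- This is ℵ₁ · ℵ₁ = ℵ₁: x goes to a bound of both its chosen index ξ and its value under the
      -- map for `P ξ`. Below any μ there are then countably many indices, each contributing
      -- countably many points.
      small-union-J₁ : ∀ {P : J₁ → Pred (ℕ → Bool) 0ℓ} → (∀ ξ → Small (P ξ)) → Small (λ x → ∃ λ ξ → P ξ x)
      small-union-J₁ {P} P-small = (λ x → proj₁ (bound x)) , λ μ → countable-⊆
        (λ {x} (x∈ , m≼μ) →
          let _ , index≼ , map≼ = bound x in
          index x , ≼-trans _ _ _ index≼ m≼μ , choose-spec (λ ξ → P ξ x) j₁ x∈ , ≼-trans _ _ _ map≼ m≼μ)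
        (countable-union (initial-countable μ) λ {ξ} _ → proj₂ (P-small ξ) μ)
        where
        index : (ℕ → Bool) → J₁
        index x = choose (λ ξ → P ξ x) j₁
        bound : ∀ x → ∃ λ μ → r₁ (index x) ≼ r₁ μ × r₁ (proj₁ (P-small (index x)) x) ≼ r₁ μ
        bound x = upperBound (index x) (proj₁ (P-small (index x)) x)

      -- If m witnesses that the continuum is small, ordering it by m first and by r second makes
      -- all initial segments countable.
      continuum-not-small : ¬ Small (λ _ → ⊤)
      continuum-not-small (m , m-countable) = ¬CH (ω₁-ordered⇒CH
        (rank , rank-injective total , λ x →
          countable-⊆ (λ y≺x → tt , ⊏⇒≼ (rank-reflects total y≺x)) (m-countable (m x))))
        where
        _⊏_ : Rel (ℕ → Bool) 0ℓ
        x ⊏ y = r₁ (m x) ≺ r₁ (m y) ⊎ m x ≡ m y × x ◂ y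
        ⊏⇒≼ : ∀ {x y} → x ⊏ y → r₁ (m x) ≼ r₁ (m y)
        ⊏⇒≼ (inj₁ p)        = ≺⇒≼ _ _ p
        ⊏⇒≼ {x} (inj₂ (eq , _)) = subst (λ ξ → r₁ (m x) ≼ r₁ ξ) eq (≼-refl _)
        -- The inner induction, along `_◂_` within one fibre of `m`; `accessible` is the outer one,
        -- on the ordinal of the fibre.
        accessibleIn : ∀ {α} → (∀ y → r₁ (m y) ≺ α → Acc _⊏_ y) →
                       ∀ {x} → r₁ (m x) ≡ α → Acc _◂_ x → Acc _⊏_ x
        accessibleIn lower eq (acc rs) = acc λ
          { {y} (inj₁ p)         → lower y (subst (_ ≺_) eq p)
          ; {y} (inj₂ (eq′ , p)) → accessibleIn lower (trans (cong r₁ eq′) eq) (rs p)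
          }
        accessible : ∀ {α} → Acc _≺_ α → ∀ {x} → r₁ (m x) ≡ α → Acc _⊏_ x
        accessible (acc rs) {x} eq =
          accessibleIn (λ y p → accessible (rs p) refl) eq (◂-wellFounded x)
        total : ∀ x y → x ⊏ y ⊎ x ≡ y ⊎ y ⊏ x
        total x y with ≺-cmp (r₁ (m x)) (r₁ (m y))
        ... | inj₁ p        = inj₁ (inj₁ p)
        ... | inj₂ (inj₂ p) = inj₂ (inj₂ (inj₁ p))
        ... | inj₂ (inj₁ p) with ◂-total x y
        ... | inj₁ q        = inj₁ (inj₂ (C₁.rᴱ-injective p , q))
        ... | inj₂ (inj₁ q) = inj₂ (inj₁ q)
        ... | inj₂ (inj₂ q) = inj₂ (inj₂ (inj₂ (sym (C₁.rᴱ-injective p) , q)))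
        open RankHit {_<_ = _⊏_} (λ x → accessible (≺-wellFounded _) refl)

      module C₂ = Segments r r-injective Small small-⊆ small-insert continuum-not-small

      J₂ : Set
      J₂ = C₂.Element

      j₂ : J₂
      j₂ = C₂.element small-empty

      D₁ D₂ : DenseOrder
      D₁ = _×ℚ j₁ r₁ C₁.rᴱ-injective
      D₂ = _×ℚ j₂ C₂.rᴱ C₂.rᴱ-injective

      M N : Structure orderLanguage
      M = orderStructure D₁
      N = orderStructure D₂

      -- An isomorphism would take the constant sequences over J₁, which are cofinal in M*, to a
      -- family bounded in N*.
      ¬isomorphic : (𝒰 : Ultrafilter ℕ) → ¬ (ultrapower M 𝒰 ≃ ultrapower N 𝒰)
      ¬isomorphic 𝒰 M*≃N* = proper (upward contradictory
        (intersection Fx≈y (⇒ (rel-iso tt (x ∷ constant ξ ∷ [])) (upward (λ {n} _ → inj₁ (x<ξ n)) full))))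
        where
        open Ultrafilter 𝒰
        open _≃_ M*≃N*
        constant : J₁ → ℕ → J₁ × ℚ
        constant ξ _ = ξ , 0ℚ
        -- Two bounds in succession: over the countably many coordinates of one image, then, in
        -- `boundAll`, over the ℵ₁ many images. They hold at every index, whatever 𝒰 is.
        boundAt : ∀ ξ → ∃ λ z → C₂.Core z × ∀ n → proj₁ (proj₁ (to (constant ξ) n)) ◂ z
        boundAt ξ = C₂.bounded small-union-ℕ (λ n → proj₁ (proj₁ (to (constant ξ) n)))
          (λ n → decide-sound (proj₂ (proj₁ (to (constant ξ) n))))
        boundAll : ∃ λ z → C₂.Core z × ∀ ξ → proj₁ (boundAt ξ) ◂ z
        boundAll = C₂.bounded small-union-J₁ (λ ξ → proj₁ (boundAt ξ)) (λ ξ → proj₁ (proj₂ (boundAt ξ)))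
        top : J₂
        top = proj₁ boundAll , decide-complete (proj₁ (proj₂ boundAll))
        preimage : ∃ λ x → ∀ {z} → Structure._≈_ (ultrapower M 𝒰) z x → Large (λ n → to z n ≡ (top , 0ℚ))
        preimage = Bijection.surjective bijection (λ _ → top , 0ℚ)
        x : ℕ → J₁ × ℚ
        x = proj₁ preimage
        Fx≈y : Large (λ n → to x n ≡ (top , 0ℚ))
        Fx≈y = proj₂ preimage (upward (λ _ → refl) full)
        -- Countably many coordinates are bounded in J₁, so the constant sequence at ξ exceeds x
        -- everywhere; its image would have to exceed the constant sequence at `top`.
        boundX : ∃ λ z → C₁.Core z × ∀ n → proj₁ (proj₁ (x n)) ◂ z
        boundX = C₁.bounded countable-union-ℕ (λ n → proj₁ (proj₁ (x n))) (λ n → decide-sound (proj₂ (proj₁ (x n))))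
        ξ : J₁
        ξ = proj₁ boundX , decide-complete (proj₁ (proj₂ boundX))
        x<ξ : ∀ n → r₁ (proj₁ (x n)) ≺ r₁ ξ
        x<ξ = proj₂ (proj₂ boundX)
        Fξ<top : ∀ n → DenseOrder._⊏_ D₂ (to (constant ξ) n) (top , 0ℚ)
        Fξ<top n = inj₁ (◂-trans {proj₁ (proj₁ (to (constant ξ) n))} {proj₁ (boundAt ξ)} {proj₁ boundAll}
          (proj₂ (proj₂ (boundAt ξ)) n) (proj₂ (proj₂ boundAll) ξ))
        contradictory : ∀ {n} → (to x n ≡ (top , 0ℚ)) × DenseOrder._⊏_ D₂ (to x n) (to (constant ξ) n) → ⊥
        contradictory {n} (eq , p) = DenseOrder.⊏-irrefl D₂ {top , 0ℚ}
          (DenseOrder.⊏-trans D₂ {top , 0ℚ} {to (constant ξ) n} {top , 0ℚ}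
            (subst (λ z → DenseOrder._⊏_ D₂ z (to (constant ξ) n)) eq p) (Fξ<top n))

    ¬CH⇒¬Keisler : ¬ KeislerCriterion
    ¬CH⇒¬Keisler criterion =
      let 𝒰 , M*≃N* = ⇒ (criterion orderLanguage orderLanguage-countable M N
                           (×ℚ-size j₁ r₁ C₁.rᴱ-injective proj₁ (C₁.element-≡ ∘ extensionality))
                           (×ℚ-size j₂ C₂.rᴱ C₂.rᴱ-injective proj₁ (C₂.element-≡ ∘ extensionality)))
                        (denseOrders-≡ₑ D₁ D₂)
      in ¬isomorphic 𝒰 M*≃N*

  Keisler⇒CH : KeislerCriterion → ContinuumHypothesis
  Keisler⇒CH criterion = byContradiction λ ¬CH →
    ¬CH⇒¬Keisler (Zermelo.position λ _ → true) (Zermelo.position-injective λ _ → true) ¬CH criterion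

corollary2p5 : Classical → (ContinuumHypothesis ⇔ KeislerCriterion)
corollary2p5 classical = mk⇔ (ω₁-ordered⇒Keisler ∘ CH⇒ω₁-ordered) Keisler⇒CH
  where open Classically classical
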